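{- Let $n$ be a nonnegative integer such that $4n+3$ is prime. Then \[ \sum_{j=0}^{n-1} t_6(j) \left( \sigma(n-j)- 4\sigma\!\left(\tfrac{n-j}{2}\right) \right) = \frac{n(n+1)(2n+1)}{6}. \]
   Context: $t_6(m)=\#\{(x_1,\dots,x_6)\in\mathbb{N}_0^6 : m=\sum_{i=1}^6\frac{x_i(x_i+1)}{2}\}$, with $\mathbb{N}_0=\{0,1,2,\dots\}$ (so $t_6(0)=1$). The function $\sigma$ is defined on $\mathbb{Q}$ by $\sigma(0)=1$, $\sigma(q)=0$ if $q\in\mathbb{Q}\setminus\mathbb{N}_0$, and $\sigma(q)=\sum_{d\mid q} d$ for $q\in\mathbb{N}=\{1,2,\dots\}$. -}

module Defs where

open import Data.Nat using (ℕ; zero; suc; _+_; _*_; _∸_; _≤?_; _≟_)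
open import Data.Nat.Divisibility using (_∣?_)
open import Data.Nat.DivMod using (_/_; _%_)
open import Data.List using (List; []; _∷_; length; filter; map; upTo; concatMap)
open import Data.Nat.ListAction using (sum)
open import Data.Integer as ℤ using (ℤ; +_)

tri : ℕ → ℕ
tri x = (x * suc x) / 2

tuples : ℕ → ℕ → List (List ℕ)
tuples b zero = [] ∷ []
tuples b (suc k) = concatMap (λ x → map (x ∷_) (tuples b k)) (upTo (suc b))

-- t_6(m): number of (x_1..x_6) ∈ ℕ₀^6 with m = Σ x_i(x_i+1)/2.
-- Since x ≤ x(x+1)/2, every solution has all x_i ≤ m, so enumerating
-- {0..m}^6 counts all solutions.
t6 : ℕ → ℕ
t6 m = length (filter (λ xs → sum (map tri xs) ≟ m) (tuples m 6))

σ : ℕ → ℕ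
σ zero = 1
σ q@(suc _) = sum (filter (λ d → d ∣? q) (upTo (suc q)))

-- σ(k/2) for k ∈ ℕ, with σ on ℚ: zero if k/2 ∉ ℕ₀ (k odd), else σ(k/2)
σhalf : ℕ → ℕ
σhalf k with k % 2
... | zero = σ (k / 2)
... | suc _ = 0

sumBelow : ℕ → (ℕ → ℤ) → ℤ
sumBelow zero f = + 0
sumBelow (suc n) f = sumBelow n f ℤ.+ f n

{-# OPTIONS --safe #-}
-- Let ψ = Σ q^(x(x+1)/2), so that Σ t₆(m) q^m = ψ⁶, and let D = q d/dq. Two facts are needed: D ψ = ψ S with
-- S = Σ (σ(m) − 4σ(m/2)) q^m, and −8 t₆(n) = C(n) := Σ χ(d) d² over d e = 4n+3, where χ is the odd character
-- modulo 4. The first gives n t₆(n) = 6 Σ t₆(j) S(n−j), and for 4n+3 prime the second gives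
-- t₆(n) = ((4n+3)² − 1)/8 = (n+1)(2n+1).
--
-- Both come from one involution of Zagier type on the triples (x, d, e), x ∈ ℤ, d, e > 0, with
-- 2x(x+1) + d e = N. Put X = 2x+1 and s = X + d. The involution either sends (s, e) to (−s, e − 2s), or keeps s
-- and changes d into ± (2e − 2X − d); it fixes only the triples with e = 2s or d = 2(e − X).
-- For N = 4n+3 nothing is fixed and χ(d) s³ (e − X) changes sign. Hence its sum vanishes, which amounts to
-- ψ D C = 6 C D ψ; as ψ⁶ satisfies the same first order equation, C is a multiple of ψ⁶.
-- For N = 4n and d, e even, (−1)^(d/2) s changes sign off the fixed triples. These exist only when n is
-- triangular, and their contribution yields D ψ = ψ S.
module Submission where

open import Defs
open import Data.Nat as ℕ using (ℕ; zero; suc; _∸_)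
open import Data.Nat.DivMod using (_/_)
open import Data.Nat.Primality using (Prime)
open import Data.Integer as ℤ using (ℤ; +_)
open import Relation.Binary.PropositionalEquality using (_≡_)

-- The weights are dictated by what survives two further symmetries, X ↦ -X (that is, x ↦ -1 - x)
-- and the exchange of d and e. For N = 4n+3 the exchange negates χ(d), and only the part d²(de -
-- 3X²) of s³(e - X) is left. With T = x(x+1)/2 one has X² = 8T + 1 and de = N - 4T, so the factor
-- de - 3X² is 4(n - 7T). As n acts on a product as D, the vanishing sum reads D(ψC) = 7 C Dψ, and 7
-- = 6 + 1 is what singles out the sixth power. The multiple is -8 because C(0) = χ(1)·1² + χ(3)·3²
-- = 1 - 9. For N = 4n the average of s over X ↦ -X is d, and d = 2f has weight 2(-1)^f f, so the
-- series that arises is -2S rather than S. Its constant term is 0, because N = 0 has no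
-- factorization into positive integers; the value σ(0) = 1 never enters. All equations stay over ℤ:
-- constant factors are carried along and cancelled, never divided out.

module SixTriangularNumbers where

  open import Data.Nat using (_≤_; _<_; z≤n; s≤s)
  import Data.Nat.Properties as ℕₚ
  open import Data.Nat.DivMod using (_%_; m/n*n≡m; m*n/n≡m; m≡m%n+[m/n]*n; m%n<n)
  open import Data.Nat.Divisibility using (_∣_; _∣?_; divides; ∣⇒≤; ∣m∣n⇒∣m+n; n∣m*n; *-cancelˡ-∣; *-monoʳ-∣)
  open import Data.Nat.Induction using (<-rec)
  open import Data.Nat.ListAction using (sum)
  open import Data.Nat.Primality using (prime⇒irreducible; prime⇒nonTrivial)
  open import Data.Integer using (-[1+_]; +[1+_]; +0; 0ℤ; 1ℤ; -1ℤ; _+_; _*_; -_; _-_)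
  import Data.Integer.Properties as ℤₚ
  open import Data.Integer.DivMod using (_%ℕ_; _/ℕ_; a≡a%ℕn+[a/ℕn]*n; n%ℕd<d)
  open import Data.Integer.Tactic.RingSolver using (solve-∀)
  open import Data.List using (List; []; _∷_; _++_; map; filter; cartesianProduct; concatMap; length; upTo)
  open import Data.List.Properties using (filter-accept; filter-reject; filter-++; upTo-∷ʳ)
  open import Data.List.Membership.Propositional using (_∈_)
  open import Data.List.Membership.Propositional.Properties
  open import Data.List.Membership.Propositional.Properties.WithK using (unique∧set⇒bag)
  open import Data.List.Relation.Binary.BagAndSetEquality using (∼bag⇒↭)
  open import Data.List.Relation.Binary.Permutation.Propositional as Perm using (_↭_)
  open import Data.List.Relation.Unary.All as All using ([]; _∷_)
  open import Data.List.Relation.Unary.AllPairs using ([]; _∷_)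
  open import Data.List.Relation.Unary.Any using (here; there)
  open import Data.List.Relation.Unary.Unique.Propositional using (Unique)
  import Data.List.Relation.Unary.Unique.Propositional.Properties as Unique
  open import Data.Product using (_×_; _,_; proj₁; proj₂; ∃; ∃₂)
  open import Data.Sum using (_⊎_; inj₁; inj₂)
  open import Function using (_∘_; case_of_)
  open import Function.Bundles using (mk⇔)
  open import Level using (0ℓ)
  open import Relation.Binary using (tri<; tri≈; tri>)
  open import Relation.Binary.PropositionalEquality
  open import Relation.Nullary using (¬_; Dec; yes; no; contradiction)
  open import Relation.Nullary.Decidable using (_×-dec_)
  open import Relation.Unary using (Pred; Decidable)
  open ≡-Reasoning

  -- Finite sums

  private variable
    A B : Set

  ∑ : List A → (A → ℤ) → ℤ
  ∑ []       f = 0ℤ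
  ∑ (x ∷ xs) f = f x + ∑ xs f

  ∑-cong : ∀ (xs : List A) {f g : A → ℤ} → (∀ {x} → x ∈ xs → f x ≡ g x) → ∑ xs f ≡ ∑ xs g
  ∑-cong []       eq = refl
  ∑-cong (x ∷ xs) eq = cong₂ _+_ (eq (here refl)) (∑-cong xs (eq ∘ there))

  ∑-zero : ∀ (xs : List A) {f : A → ℤ} → (∀ {x} → x ∈ xs → f x ≡ 0ℤ) → ∑ xs f ≡ 0ℤ
  ∑-zero []       eq = refl
  ∑-zero (x ∷ xs) eq = cong₂ _+_ (eq (here refl)) (∑-zero xs (eq ∘ there))

  ∑-distrib-+ : ∀ (xs : List A) (f g : A → ℤ) → ∑ xs (λ x → f x + g x) ≡ ∑ xs f + ∑ xs g
  ∑-distrib-+ []       f g = refl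
  ∑-distrib-+ (x ∷ xs) f g = trans (cong (λ z → f x + g x + z) (∑-distrib-+ xs f g)) (lem (f x) (g x) _ _)
    where
    lem : ∀ a b c d → (a + b) + (c + d) ≡ (a + c) + (b + d)
    lem = solve-∀

  ∑-distribˡ-* : ∀ (xs : List A) c (f : A → ℤ) → ∑ xs (λ x → c * f x) ≡ c * ∑ xs f
  ∑-distribˡ-* []       c f = sym (ℤₚ.*-zeroʳ c)
  ∑-distribˡ-* (x ∷ xs) c f = trans (cong (_+_ (c * f x)) (∑-distribˡ-* xs c f)) (sym (ℤₚ.*-distribˡ-+ c (f x) _))

  ∑-++ : ∀ (xs ys : List A) (f : A → ℤ) → ∑ (xs ++ ys) f ≡ ∑ xs f + ∑ ys f
  ∑-++ []       ys f = sym (ℤₚ.+-identityˡ _)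
  ∑-++ (x ∷ xs) ys f = trans (cong (_+_ (f x)) (∑-++ xs ys f)) (sym (ℤₚ.+-assoc (f x) _ _))

  ∑-map : ∀ (h : A → B) (xs : List A) (f : B → ℤ) → ∑ (map h xs) f ≡ ∑ xs (f ∘ h)
  ∑-map h []       f = refl
  ∑-map h (x ∷ xs) f = cong (_+_ (f (h x))) (∑-map h xs f)

  ∑-↭ : ∀ {xs ys : List A} (f : A → ℤ) → xs ↭ ys → ∑ xs f ≡ ∑ ys f
  ∑-↭ f Perm.refl         = refl
  ∑-↭ f (Perm.prep x p)   = cong (_+_ (f x)) (∑-↭ f p)
  ∑-↭ f (Perm.swap x y p) = trans (cong (λ z → f x + (f y + z)) (∑-↭ f p)) (lem (f x) (f y) _)
    where
    lem : ∀ a b c → a + (b + c) ≡ b + (a + c)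
    lem = solve-∀
  ∑-↭ f (Perm.trans p q)  = trans (∑-↭ f p) (∑-↭ f q)

  -- Injectivity is asked only on members of the list, because maps such as `φ` are inverted only
  -- where d and e are positive.
  map-unique : ∀ {h : A → B} (xs : List A) → (∀ {x y} → x ∈ xs → y ∈ xs → h x ≡ h y → x ≡ y) →
               Unique xs → Unique (map h xs)
  map-unique []       inj []       = []
  map-unique {h = h} (x ∷ xs) inj (x∉ ∷ u) =
    All.tabulate fresh ∷ map-unique xs (λ p q → inj (there p) (there q)) u
    where
    fresh : ∀ {z} → z ∈ map h xs → ¬ h x ≡ z
    fresh z∈ eq with y , y∈ , z≡ ← ∈-map⁻ h z∈ =
      All.lookup x∉ y∈ (inj (here refl) (there y∈) (trans eq z≡))

  -- The image of `xs` and the list `ys` have the same members and no repetitions, hence are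
  -- permutations of each other.
  ∑-bijection : ∀ {xs : List A} {ys : List B} → Unique xs → Unique ys → (h : A → B) (k : B → A) →
    (∀ {x} → x ∈ xs → h x ∈ ys) → (∀ {y} → y ∈ ys → k y ∈ xs) →
    (∀ {x} → x ∈ xs → k (h x) ≡ x) → (∀ {y} → y ∈ ys → h (k y) ≡ y) →
    ∀ (f : B → ℤ) → ∑ xs (f ∘ h) ≡ ∑ ys f
  ∑-bijection {xs = xs} {ys} ux uy h k h∈ k∈ kh hk f =
    trans (sym (∑-map h xs f)) (∑-↭ f (∼bag⇒↭ (unique∧set⇒bag (map-unique xs inj ux) uy (mk⇔ to from))))
    where
    inj : ∀ {x y} → x ∈ xs → y ∈ xs → h x ≡ h y → x ≡ y
    inj p q eq = trans (sym (kh p)) (trans (cong k eq) (kh q))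
    to : ∀ {z} → z ∈ map h xs → z ∈ ys
    to z∈ with x , x∈ , refl ← ∈-map⁻ h z∈ = h∈ x∈
    from : ∀ {z} → z ∈ ys → z ∈ map h xs
    from {z} z∈ = subst (_∈ map h xs) (hk z∈) (∈-map⁺ h (k∈ z∈))

  ∑-set-cong : ∀ {xs ys : List A} → Unique xs → Unique ys → (∀ {x} → x ∈ xs → x ∈ ys) →
               (∀ {x} → x ∈ ys → x ∈ xs) → ∀ f → ∑ xs f ≡ ∑ ys f
  ∑-set-cong ux uy to from = ∑-bijection ux uy (λ x → x) (λ x → x) to from (λ _ → refl) (λ _ → refl)

  module _ {P : Pred A 0ℓ} (P? : Decidable P) where

    ∑-filter-support : ∀ xs {f : A → ℤ} → (∀ {x} → x ∈ xs → ¬ P x → f x ≡ 0ℤ) →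
                       ∑ xs f ≡ ∑ (filter P? xs) f
    ∑-filter-support []       zero′ = refl
    ∑-filter-support (x ∷ xs) {f} zero′ with P? x
    ... | yes _ = cong (_+_ (f x)) (∑-filter-support xs (zero′ ∘ there))
    ... | no ¬p = trans (cong₂ _+_ (zero′ (here refl) ¬p) (∑-filter-support xs (zero′ ∘ there))) (ℤₚ.+-identityˡ _)

  filter-map : ∀ {P : Pred B 0ℓ} (P? : Decidable P) (h : A → B) xs →
               filter P? (map h xs) ≡ map h (filter (P? ∘ h) xs)
  filter-map P? h []       = refl
  filter-map P? h (x ∷ xs) with P? (h x)
  ... | yes _ = cong (h x ∷_) (filter-map P? h xs)
  ... | no  _ = filter-map P? h xs

  -- Serves to group the solutions (x, d, e) by x.
  ∑-filter-cartesianProduct : ∀ {P : Pred (A × B) 0ℓ} (P? : Decidable P) xs ys (f : A × B → ℤ) →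
    ∑ (filter P? (cartesianProduct xs ys)) f ≡
    ∑ xs (λ x → ∑ (filter (λ y → P? (x , y)) ys) (λ y → f (x , y)))
  ∑-filter-cartesianProduct P? []       ys f = refl
  ∑-filter-cartesianProduct P? (x ∷ xs) ys f = begin
    ∑ (filter P? (map (x ,_) ys ++ cartesianProduct xs ys)) f
      ≡⟨ cong (λ l → ∑ l f) (filter-++ P? (map (x ,_) ys) _) ⟩
    ∑ (filter P? (map (x ,_) ys) ++ filter P? (cartesianProduct xs ys)) f
      ≡⟨ ∑-++ (filter P? (map (x ,_) ys)) _ f ⟩
    ∑ (filter P? (map (x ,_) ys)) f + ∑ (filter P? (cartesianProduct xs ys)) f
      ≡⟨ cong₂ _+_ (trans (cong (λ l → ∑ l f) (filter-map P? (x ,_) ys)) (∑-map (x ,_) (filter (P? ∘ (x ,_)) ys) f))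
                   (∑-filter-cartesianProduct P? xs ys f) ⟩
    _ ∎
    where open ≡-Reasoning

  ∑-involution : ∀ (xs : List A) → Unique xs → (φ : A → A) → (∀ {x} → x ∈ xs → φ x ∈ xs) →
    (∀ {x} → x ∈ xs → φ (φ x) ≡ x) → (f : A → ℤ) → ∑ xs (f ∘ φ) ≡ ∑ xs f
  ∑-involution xs u φ φ∈ inv = ∑-bijection u u φ φ φ∈ φ∈ inv inv

  -- Power series

  Series : Set
  Series = ℕ → ℤ

  infixl 7 _⊛_
  -- Cauchy product, obtained by splitting f into its constant term and its tail. No index is ever
  -- subtracted, and laws follow by induction on n with f generalized to its tail.
  _⊛_ : Series → Series → Series
  (f ⊛ g) zero    = f 0 * g 0
  (f ⊛ g) (suc n) = f 0 * g (suc n) + (f ∘ suc ⊛ g) n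

  D : Series → Series
  D f n = + n * f n

  one : Series
  one zero    = 1ℤ
  one (suc _) = 0ℤ

  -- Coefficient n sees only coefficients up to n. This permits truncations of ψ and strong
  -- induction on coefficients.
  ⊛-cong-≤ : ∀ n {f f′ g g′} → (∀ {i} → i ≤ n → f i ≡ f′ i) → (∀ {i} → i ≤ n → g i ≡ g′ i) →
             (f ⊛ g) n ≡ (f′ ⊛ g′) n
  ⊛-cong-≤ zero    p q = cong₂ _*_ (p z≤n) (q z≤n)
  ⊛-cong-≤ (suc n) p q = cong₂ _+_ (cong₂ _*_ (p z≤n) (q ℕₚ.≤-refl))
                                   (⊛-cong-≤ n (p ∘ s≤s) (q ∘ ℕₚ.m≤n⇒m≤1+n))

  ⊛-cong : ∀ {f f′ g g′} → f ≗ f′ → g ≗ g′ → f ⊛ g ≗ f′ ⊛ g′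
  ⊛-cong p q n = ⊛-cong-≤ n (λ {i} _ → p i) (λ {i} _ → q i)

  -- The defining recursion with the roles of the factors exchanged; commutativity rests on it.
  ⊛-unfoldʳ : ∀ f g n → (f ⊛ g) (suc n) ≡ f (suc n) * g 0 + (f ⊛ (g ∘ suc)) n
  ⊛-unfoldʳ f g zero    = ℤₚ.+-comm (f 0 * g 1) (f 1 * g 0)
  ⊛-unfoldʳ f g (suc n) = trans (cong (_+_ (f 0 * g (suc (suc n)))) (⊛-unfoldʳ (f ∘ suc) g n))
                                (lem (f 0 * g (suc (suc n))) (f (suc (suc n)) * g 0) _)
    where
    lem : ∀ a b c → a + (b + c) ≡ b + (a + c)
    lem = solve-∀

  ⊛-comm : ∀ f g → f ⊛ g ≗ g ⊛ f
  ⊛-comm f g zero    = ℤₚ.*-comm (f 0) (g 0)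
  ⊛-comm f g (suc n) = trans (cong₂ _+_ (ℤₚ.*-comm (f 0) (g (suc n))) (⊛-comm (f ∘ suc) g n))
                             (sym (⊛-unfoldʳ g f n))

  ⊛-distribʳ-+ : ∀ f h g n → ((λ i → f i + h i) ⊛ g) n ≡ (f ⊛ g) n + (h ⊛ g) n
  ⊛-distribʳ-+ f h g zero    = ℤₚ.*-distribʳ-+ (g 0) (f 0) (h 0)
  ⊛-distribʳ-+ f h g (suc n) = trans (cong (_+_ ((f 0 + h 0) * g (suc n))) (⊛-distribʳ-+ (f ∘ suc) (h ∘ suc) g n))
                                     (lem (f 0) (h 0) (g (suc n)) _ _)
    where
    lem : ∀ a b c x y → (a + b) * c + (x + y) ≡ (a * c + x) + (b * c + y)
    lem = solve-∀

  ⊛-scaleˡ : ∀ c f g n → ((λ i → c * f i) ⊛ g) n ≡ c * (f ⊛ g) n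
  ⊛-scaleˡ c f g zero    = ℤₚ.*-assoc c (f 0) (g 0)
  ⊛-scaleˡ c f g (suc n) = trans (cong (_+_ (c * f 0 * g (suc n))) (⊛-scaleˡ c (f ∘ suc) g n))
                                 (lem c (f 0) (g (suc n)) _)
    where
    lem : ∀ c a b x → c * a * b + c * x ≡ c * (a * b + x)
    lem = solve-∀

  ⊛-scaleʳ : ∀ c f g n → (f ⊛ (λ i → c * g i)) n ≡ c * (f ⊛ g) n
  ⊛-scaleʳ c f g n = begin
    (f ⊛ (λ i → c * g i)) n ≡⟨ ⊛-comm f _ n ⟩
    ((λ i → c * g i) ⊛ f) n ≡⟨ ⊛-scaleˡ c g f n ⟩
    c * (g ⊛ f) n           ≡⟨ cong (c *_) (⊛-comm g f n) ⟩
    c * (f ⊛ g) n           ∎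

  ⊛-assoc : ∀ f g h → (f ⊛ g) ⊛ h ≗ f ⊛ (g ⊛ h)
  ⊛-assoc f g h zero    = ℤₚ.*-assoc (f 0) (g 0) (h 0)
  ⊛-assoc f g h (suc n) = begin
    f 0 * g 0 * h (suc n) + ((λ i → f 0 * g (suc i) + (f ∘ suc ⊛ g) i) ⊛ h) n
      ≡⟨ cong (_+_ (f 0 * g 0 * h (suc n)))
           (trans (⊛-distribʳ-+ (λ i → f 0 * g (suc i)) (f ∘ suc ⊛ g) h n)
                  (cong₂ _+_ (⊛-scaleˡ (f 0) (g ∘ suc) h n) (⊛-assoc (f ∘ suc) g h n))) ⟩
    f 0 * g 0 * h (suc n) + (f 0 * (g ∘ suc ⊛ h) n + (f ∘ suc ⊛ (g ⊛ h)) n)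
      ≡⟨ lem (f 0) (g 0) (h (suc n)) _ _ ⟩
    f 0 * (g 0 * h (suc n) + (g ∘ suc ⊛ h) n) + (f ∘ suc ⊛ (g ⊛ h)) n ∎
    where
    lem : ∀ a b c x y → a * b * c + (a * x + y) ≡ a * (b * c + x) + y
    lem = solve-∀

  0⊛ : ∀ g n → ((λ _ → 0ℤ) ⊛ g) n ≡ 0ℤ
  0⊛ g zero    = refl
  0⊛ g (suc n) = trans (ℤₚ.+-identityˡ _) (0⊛ g n)

  one⊛ : ∀ g → one ⊛ g ≗ g
  one⊛ g zero    = ℤₚ.*-identityˡ (g 0)
  one⊛ g (suc n) = trans (cong₂ _+_ (ℤₚ.*-identityˡ (g (suc n))) (0⊛ g n)) (ℤₚ.+-identityʳ _)

  ∑⊛ : ∀ (xs : List A) (F : A → Series) g n →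
       ((λ i → ∑ xs (λ x → F x i)) ⊛ g) n ≡ ∑ xs (λ x → (F x ⊛ g) n)
  ∑⊛ []       F g n = 0⊛ g n
  ∑⊛ (x ∷ xs) F g n = trans (⊛-distribʳ-+ (F x) _ g n) (cong (_+_ ((F x ⊛ g) n)) (∑⊛ xs F g n))

  D-suc : ∀ f n → D f (suc n) ≡ D (f ∘ suc) n + f (suc n)
  D-suc f n = trans (cong (_* f (suc n)) (ℤₚ.+-comm 1ℤ (+ n))) (lem (+ n) (f (suc n)))
    where
    lem : ∀ a b → (a + 1ℤ) * b ≡ a * b + b
    lem = solve-∀

  D-⊛ : ∀ f g n → D (f ⊛ g) n ≡ (D f ⊛ g) n + (f ⊛ D g) n
  D-⊛ f g zero    = lem (f 0) (g 0)
    where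
    lem : ∀ a b → 0ℤ * (a * b) ≡ 0ℤ * a * b + a * (0ℤ * b)
    lem = solve-∀
  D-⊛ f g (suc n) = begin
    D (f ⊛ g) (suc n)
      ≡⟨ D-suc (f ⊛ g) n ⟩
    + n * (f 0 * g (suc n) + c) + (f 0 * g (suc n) + c)
      ≡⟨ lem₁ (+ n) (f 0) (g (suc n)) c ⟩
    f 0 * (+ n * g (suc n) + g (suc n)) + (c + + n * c)
      ≡⟨ cong₂ (λ x y → f 0 * x + (c + y)) (sym (D-suc g n)) (D-⊛ (f ∘ suc) g n) ⟩
    f 0 * D g (suc n) + (c + ((D (f ∘ suc) ⊛ g) n + (f ∘ suc ⊛ D g) n))
      ≡⟨ lem₂ (f 0) (g (suc n)) (D g (suc n)) c ((D (f ∘ suc) ⊛ g) n) ((f ∘ suc ⊛ D g) n) ⟩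
    (0ℤ * f 0 * g (suc n) + ((D (f ∘ suc) ⊛ g) n + c)) + (f 0 * D g (suc n) + (f ∘ suc ⊛ D g) n)
      ≡⟨ cong (λ z → (0ℤ * f 0 * g (suc n) + z) + (f ⊛ D g) (suc n))
           (trans (sym (⊛-distribʳ-+ (D (f ∘ suc)) (f ∘ suc) g n))
                  (⊛-cong (λ i → sym (D-suc f i)) (λ _ → refl) n)) ⟩
    (D f ⊛ g) (suc n) + (f ⊛ D g) (suc n) ∎
    where
    c = (f ∘ suc ⊛ g) n
    lem₁ : ∀ n a b c → n * (a * b + c) + (a * b + c) ≡ a * (n * b + b) + (c + n * c)
    lem₁ = solve-∀
    lem₂ : ∀ a b d c x y → a * d + (c + (x + y)) ≡ (0ℤ * a * b + (x + c)) + (a * d + y)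
    lem₂ = solve-∀

  infixr 8 _^⊛_
  _^⊛_ : Series → ℕ → Series
  f ^⊛ zero  = one
  f ^⊛ suc k = f ⊛ f ^⊛ k

  ^⊛-cong-≤ : ∀ k n {f g} → (∀ {i} → i ≤ n → f i ≡ g i) → (f ^⊛ k) n ≡ (g ^⊛ k) n
  ^⊛-cong-≤ zero    n p = refl
  ^⊛-cong-≤ (suc k) n p = ⊛-cong-≤ n p (λ {i} i≤n → ^⊛-cong-≤ k i (λ j≤i → p (ℕₚ.≤-trans j≤i i≤n)))

  module LogarithmicDerivative (ψ G : Series) (c : ℤ) (eq : ∀ n → c * D ψ n ≡ (ψ ⊛ G) n) where

    -- The logarithmic derivative of a k-th power is k times that of the base, with the denominator
    -- c cleared; induction on k by the Leibniz rule.
    D-^⊛ : ∀ k n → c * D (ψ ^⊛ k) n ≡ + k * ((ψ ^⊛ k) ⊛ G) n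
    D-^⊛ zero    zero    = trans (cong (c *_) (ℤₚ.*-zeroˡ 1ℤ)) (ℤₚ.*-zeroʳ c)
    D-^⊛ zero    (suc n) = trans (cong (c *_) (ℤₚ.*-zeroʳ (+ suc n))) (ℤₚ.*-zeroʳ c)
    D-^⊛ (suc k) n = begin
      c * D (ψ ⊛ P) n
        ≡⟨ cong (c *_) (D-⊛ ψ P n) ⟩
      c * ((D ψ ⊛ P) n + (ψ ⊛ D P) n)
        ≡⟨ ℤₚ.*-distribˡ-+ c ((D ψ ⊛ P) n) _ ⟩
      c * (D ψ ⊛ P) n + c * (ψ ⊛ D P) n
        ≡⟨ cong₂ _+_ (sym (⊛-scaleˡ c (D ψ) P n)) (sym (⊛-scaleʳ c ψ (D P) n)) ⟩
      ((λ i → c * D ψ i) ⊛ P) n + (ψ ⊛ (λ i → c * D P i)) n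
        ≡⟨ cong₂ _+_ (⊛-cong eq (λ _ → refl) n) (⊛-cong (λ _ → refl) (D-^⊛ k) n) ⟩
      (ψ ⊛ G ⊛ P) n + (ψ ⊛ (λ i → + k * (P ⊛ G) i)) n
        ≡⟨ cong₂ _+_ (ψGP n) (trans (⊛-scaleʳ (+ k) ψ (P ⊛ G) n) (cong (+ k *_) (sym (⊛-assoc ψ P G n)))) ⟩
      (ψ ⊛ P ⊛ G) n + + k * (ψ ⊛ P ⊛ G) n
        ≡⟨ lem (+ k) ((ψ ⊛ P ⊛ G) n) ⟩
      (1ℤ + + k) * (ψ ⊛ P ⊛ G) n ∎
      where
      P = ψ ^⊛ k
      ψGP : ψ ⊛ G ⊛ P ≗ ψ ⊛ P ⊛ G
      ψGP n = trans (⊛-assoc ψ G P n) (trans (⊛-cong (λ _ → refl) (⊛-comm G P) n) (sym (⊛-assoc ψ P G n)))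
      lem : ∀ k x → x + k * x ≡ (1ℤ + k) * x
      lem = solve-∀

    -- Eliminates G: after multiplication by c both sides are k times the product of G and the
    -- (k+1)-st power of ψ. What remains is the first order equation that is compared with the one
    -- for C.
    ⊛-D-^⊛ : .{{_ : ℤ.NonZero c}} → ∀ k n → (ψ ⊛ D (ψ ^⊛ k)) n ≡ + k * (D ψ ⊛ ψ ^⊛ k) n
    ⊛-D-^⊛ k n = ℤₚ.*-cancelˡ-≡ c _ _ (begin
      c * (ψ ⊛ D P) n              ≡⟨ sym (⊛-scaleʳ c ψ (D P) n) ⟩
      (ψ ⊛ (λ i → c * D P i)) n    ≡⟨ ⊛-cong (λ _ → refl) (D-^⊛ k) n ⟩
      (ψ ⊛ (λ i → + k * (P ⊛ G) i)) n ≡⟨ ⊛-scaleʳ (+ k) ψ (P ⊛ G) n ⟩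
      + k * (ψ ⊛ (P ⊛ G)) n        ≡⟨ cong (+ k *_) (ψPG n) ⟩
      + k * (ψ ⊛ G ⊛ P) n          ≡⟨ cong (+ k *_) (sym (⊛-cong eq (λ _ → refl) n)) ⟩
      + k * ((λ i → c * D ψ i) ⊛ P) n ≡⟨ cong (+ k *_) (⊛-scaleˡ c (D ψ) P n) ⟩
      + k * (c * (D ψ ⊛ P) n)      ≡⟨ lem (+ k) c _ ⟩
      c * (+ k * (D ψ ⊛ P) n)      ∎)
      where
      P = ψ ^⊛ k
      ψPG : ψ ⊛ (P ⊛ G) ≗ ψ ⊛ G ⊛ P
      ψPG n = trans (⊛-cong (λ _ → refl) (⊛-comm P G) n) (sym (⊛-assoc ψ G P n))
      lem : ∀ k c x → k * (c * x) ≡ c * (k * x)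
      lem = solve-∀

  -- Comparing coefficients of ψ D f = c f D ψ expresses n f(n) through smaller coefficients.
  unique-solution : ∀ ψ c f g → ψ 0 ≡ 1ℤ →
    (∀ n → (ψ ⊛ D f) n ≡ c * (D ψ ⊛ f) n) → (∀ n → (ψ ⊛ D g) n ≡ c * (D ψ ⊛ g) n) →
    f 0 ≡ g 0 → f ≗ g
  unique-solution ψ c f g ψ0 rec-f rec-g f0 = <-rec (λ n → f n ≡ g n) step
    where
    leading : ∀ h n → (∀ n → (ψ ⊛ D h) n ≡ c * (D ψ ⊛ h) n) →
              + suc n * h (suc n) ≡ c * (D ψ ∘ suc ⊛ h) n - (ψ ∘ suc ⊛ D h) n
    leading h n rec = begin
      + suc n * h (suc n)
        ≡⟨ lem₁ (+ suc n * h (suc n)) ((ψ ∘ suc ⊛ D h) n) ⟩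
      (1ℤ * (+ suc n * h (suc n)) + (ψ ∘ suc ⊛ D h) n) - (ψ ∘ suc ⊛ D h) n
        ≡⟨ cong (λ z → (z * (+ suc n * h (suc n)) + (ψ ∘ suc ⊛ D h) n) - (ψ ∘ suc ⊛ D h) n) (sym ψ0) ⟩
      (ψ ⊛ D h) (suc n) - (ψ ∘ suc ⊛ D h) n
        ≡⟨ cong (_- (ψ ∘ suc ⊛ D h) n) (rec (suc n)) ⟩
      -- `D ψ` has no constant term, so `h (suc n)` drops out on this side.
      c * (0ℤ * ψ 0 * h (suc n) + (D ψ ∘ suc ⊛ h) n) - (ψ ∘ suc ⊛ D h) n
        ≡⟨ cong (λ z → c * z - (ψ ∘ suc ⊛ D h) n) (lem₂ (ψ 0) (h (suc n)) _) ⟩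
      c * (D ψ ∘ suc ⊛ h) n - (ψ ∘ suc ⊛ D h) n ∎
      where
      lem₁ : ∀ a b → a ≡ (1ℤ * a + b) - b
      lem₁ = solve-∀
      lem₂ : ∀ a b d → 0ℤ * a * b + d ≡ d
      lem₂ = solve-∀
    step : ∀ n → (∀ {m} → m < n → f m ≡ g m) → f n ≡ g n
    step zero    ih = f0
    step (suc n) ih = ℤₚ.*-cancelˡ-≡ (+ suc n) _ _ (begin
      + suc n * f (suc n)
        ≡⟨ leading f n rec-f ⟩
      c * (D ψ ∘ suc ⊛ f) n - (ψ ∘ suc ⊛ D f) n
        ≡⟨ cong₂ (λ x y → c * x - y) (⊛-cong-≤ n (λ _ → refl) (ih ∘ s≤s))
                                     (⊛-cong-≤ n (λ _ → refl) (λ {i} i≤n → cong (+ i *_) (ih (s≤s i≤n)))) ⟩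
      c * (D ψ ∘ suc ⊛ g) n - (ψ ∘ suc ⊛ D g) n
        ≡⟨ sym (leading g n rec-g) ⟩
      + suc n * g (suc n) ∎)

  -- Convolutions as finite sums, and multiplication by powers of q

  sumBelow-unfoldˡ : ∀ n f → sumBelow (suc n) f ≡ f 0 + sumBelow n (f ∘ suc)
  sumBelow-unfoldˡ zero    f = ℤₚ.+-comm 0ℤ (f 0)
  sumBelow-unfoldˡ (suc n) f = trans (cong (_+ f (suc n)) (sumBelow-unfoldˡ n f)) (ℤₚ.+-assoc (f 0) _ _)

  ⊛-sumBelow : ∀ n f g → (f ⊛ g) n ≡ sumBelow (suc n) (λ j → f j * g (n ∸ j))
  ⊛-sumBelow zero    f g = sym (ℤₚ.+-identityˡ _)
  ⊛-sumBelow (suc n) f g = trans (cong (_+_ (f 0 * g (suc n))) (⊛-sumBelow n (f ∘ suc) g))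
                                 (sym (sumBelow-unfoldˡ (suc n) (λ j → f j * g (suc n ∸ j))))

  sumBelow-cong : ∀ n {f g} → (∀ {j} → j < n → f j ≡ g j) → sumBelow n f ≡ sumBelow n g
  sumBelow-cong zero    p = refl
  sumBelow-cong (suc n) p = cong₂ _+_ (sumBelow-cong n (λ j<n → p (ℕₚ.m≤n⇒m≤1+n j<n))) (p ℕₚ.≤-refl)

  sumBelow-distribˡ-* : ∀ n c f → sumBelow n (λ j → c * f j) ≡ c * sumBelow n f
  sumBelow-distribˡ-* zero    c f = sym (ℤₚ.*-zeroʳ c)
  sumBelow-distribˡ-* (suc n) c f = trans (cong (_+ c * f n) (sumBelow-distribˡ-* n c f))
                                          (sym (ℤₚ.*-distribˡ-+ c _ (f n)))

  shift : ℕ → Series → Series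
  shift zero    g n       = g n
  shift (suc a) g zero    = 0ℤ
  shift (suc a) g (suc n) = shift a g n

  shift-≤ : ∀ {a n} g → a ≤ n → shift a g n ≡ g (n ∸ a)
  shift-≤ g z≤n     = refl
  shift-≤ g (s≤s p) = shift-≤ g p

  shift-> : ∀ {a n} g → n < a → shift a g n ≡ 0ℤ
  shift-> {n = zero}  g (s≤s p) = refl
  shift-> {n = suc n} g (s≤s p) = shift-> g p

  shift-+ : ∀ a b g n → shift (a ℕ.+ b) g n ≡ shift a (shift b g) n
  shift-+ zero    b g n       = refl
  shift-+ (suc a) b g zero    = refl
  shift-+ (suc a) b g (suc n) = shift-+ a b g n

  shift-cong : ∀ a {f g} → f ≗ g → shift a f ≗ shift a g
  shift-cong zero    p n       = p n
  shift-cong (suc a) p zero    = refl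
  shift-cong (suc a) p (suc n) = shift-cong a p n

  shift-∑ : ∀ a (xs : List A) (F : A → Series) n →
            ∑ xs (λ x → shift a (F x) n) ≡ shift a (λ i → ∑ xs (λ x → F x i)) n
  shift-∑ zero    xs F n       = refl
  shift-∑ (suc a) xs F zero    = ∑-zero xs (λ _ → refl)
  shift-∑ (suc a) xs F (suc n) = shift-∑ a xs F n

  shift⊛ : ∀ a f g n → (shift a f ⊛ g) n ≡ shift a (f ⊛ g) n
  shift⊛ zero    f g n       = refl
  shift⊛ (suc a) f g zero    = ℤₚ.*-zeroˡ (g 0)
  shift⊛ (suc a) f g (suc n) = trans (cong (_+ (shift a f ⊛ g) n) (ℤₚ.*-zeroˡ (g (suc n))))
                                     (trans (ℤₚ.+-identityˡ _) (shift⊛ a f g n))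

  -- D weighs the coefficient g(n - a) by n - a. For n < a both sides vanish, so the negative
  -- integer n - a does no harm.
  D-shift : ∀ a g n → shift a (D g) n ≡ (+ n - + a) * shift a g n
  D-shift zero    g n       = cong (_* g n) (sym (ℤₚ.+-identityʳ (+ n)))
  D-shift (suc a) g zero    = sym (ℤₚ.*-zeroʳ (0ℤ - + suc a))
  D-shift (suc a) g (suc n) = trans (D-shift a g n) (cong (_* shift a g n) (lem (+ n) (+ a)))
    where
    lem : ∀ n a → n - a ≡ (1ℤ + n) - (1ℤ + a)
    lem = solve-∀

  -- The monomial q^a. Read as a Kronecker delta in a and n, it turns counting into summation.
  δ : ℕ → Series
  δ a = shift a one

  δ-≡ : ∀ a → δ a a ≡ 1ℤ
  δ-≡ zero    = refl
  δ-≡ (suc a) = δ-≡ a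

  δ-≢ : ∀ {a n} → a ≢ n → δ a n ≡ 0ℤ
  δ-≢ {zero}  {zero}  a≢n = contradiction refl a≢n
  δ-≢ {zero}  {suc n} a≢n = refl
  δ-≢ {suc a} {zero}  a≢n = refl
  δ-≢ {suc a} {suc n} a≢n = δ-≢ (a≢n ∘ cong suc)

  length-filter-≟ : ∀ (h : A → ℕ) m xs → + length (filter (λ x → h x ℕ.≟ m) xs) ≡ ∑ xs (λ x → δ (h x) m)
  length-filter-≟ h m []       = refl
  length-filter-≟ h m (x ∷ xs) = by-cases (h x ℕ.≟ m)
    where
    P? = λ x → h x ℕ.≟ m
    by-cases : Dec (h x ≡ m) → + length (filter P? (x ∷ xs)) ≡ δ (h x) m + ∑ xs (λ x → δ (h x) m)
    by-cases (yes ≡m) = trans (cong (λ l → + length l) (filter-accept P? {xs = xs} ≡m))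
                              (cong₂ _+_ (sym (trans (cong (λ a → δ a m) ≡m) (δ-≡ m))) (length-filter-≟ h m xs))
    by-cases (no  ≢m) = trans (cong (λ l → + length l) (filter-reject P? {xs = xs} ≢m))
                              (trans (length-filter-≟ h m xs)
                                     (trans (sym (ℤₚ.+-identityˡ _)) (cong (_+ ∑ xs (λ x → δ (h x) m)) (sym (δ-≢ ≢m)))))

  ∑-concatMap : ∀ (k : A → List B) xs (f : B → ℤ) → ∑ (concatMap k xs) f ≡ ∑ xs (λ x → ∑ (k x) f)
  ∑-concatMap k []       f = refl
  ∑-concatMap k (x ∷ xs) f = trans (∑-++ (k x) (concatMap k xs) f) (cong (_+_ (∑ (k x) f)) (∑-concatMap k xs f))

  -- Triangular numbers and the series ψ

  2*tri : ∀ k → tri k ℕ.* 2 ≡ k ℕ.* suc k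
  2*tri k = m/n*n≡m (even k)
    where
    even : ∀ k → 2 ∣ k ℕ.* suc k
    even zero    = divides 0 refl
    even (suc k) = subst (2 ∣_) (trans (sym (ℕₚ.*-distribʳ-+ (suc k) k 2))
                                       (trans (cong (ℕ._* suc k) (ℕₚ.+-comm k 2)) (ℕₚ.*-comm (suc (suc k)) (suc k))))
                         (∣m∣n⇒∣m+n (even k) (subst (2 ∣_) (ℕₚ.*-comm (suc k) 2) (n∣m*n (suc k))))

  n≤tri : ∀ k → k ≤ tri k
  n≤tri zero    = z≤n
  n≤tri (suc k) = ℕₚ.*-cancelʳ-≤ (suc k) (tri (suc k)) 2
    (subst (suc k ℕ.* 2 ≤_) (sym (2*tri (suc k))) (ℕₚ.*-monoʳ-≤ (suc k) (s≤s (s≤s z≤n))))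

  ψ-below : ℕ → Series
  ψ-below K n = ∑ (upTo K) (λ k → δ (tri k) n)

  -- Coefficient n is read off the truncation to k ≤ n, which suffices because k ≤ `tri k`.
  ψ : Series
  ψ n = ψ-below (suc n) n

  -- Every additional index q > n contributes a monomial of degree `tri q` ≥ q > n.
  ψ-below≡ψ : ∀ {K n} → n < K → ψ-below K n ≡ ψ n
  ψ-below≡ψ {K} {n} n<K with p , refl ← ℕₚ.m≤n⇒∃[o]m+o≡n n<K = go p
    where
    go : ∀ p → ψ-below (suc n ℕ.+ p) n ≡ ψ n
    go zero    = cong (λ K → ψ-below K n) (ℕₚ.+-identityʳ (suc n))
    go (suc p) = begin
      ψ-below (suc n ℕ.+ suc p) n
        ≡⟨ cong (λ K → ψ-below K n) (ℕₚ.+-suc (suc n) p) ⟩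
      ∑ (upTo (suc q)) f
        ≡⟨ cong (λ l → ∑ l f) (sym (upTo-∷ʳ q)) ⟩
      ∑ (upTo q ++ q ∷ []) f
        ≡⟨ ∑-++ (upTo q) (q ∷ []) f ⟩
      ∑ (upTo q) f + (f q + 0ℤ)
        ≡⟨ cong₂ (λ x y → x + (y + 0ℤ)) (go p) (δ-≢ (ℕₚ.>⇒≢ (ℕₚ.<-≤-trans (s≤s (ℕₚ.m≤m+n n p)) (n≤tri q)))) ⟩
      ψ n + (0ℤ + 0ℤ)
        ≡⟨ ℤₚ.+-identityʳ (ψ n) ⟩
      ψ n ∎
      where
      q = suc n ℕ.+ p
      f = λ k → δ (tri k) n

  -- The bound K is left free so that it can match the box in which solutions are enumerated.
  ψ⊛ : ∀ {K n} → n < K → ∀ g → (ψ ⊛ g) n ≡ ∑ (upTo K) (λ k → shift (tri k) g n)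
  ψ⊛ {K} {n} n<K g = begin
    (ψ ⊛ g) n
      ≡⟨ ⊛-cong-≤ n (λ i≤n → sym (ψ-below≡ψ (ℕₚ.≤-<-trans i≤n n<K))) (λ _ → refl) ⟩
    (ψ-below K ⊛ g) n
      ≡⟨ ∑⊛ (upTo K) (λ k → δ (tri k)) g n ⟩
    ∑ (upTo K) (λ k → (δ (tri k) ⊛ g) n)
      ≡⟨ ∑-cong (upTo K) (λ {k} _ → trans (shift⊛ (tri k) one g n) (shift-cong (tri k) (one⊛ g) n)) ⟩
    ∑ (upTo K) (λ k → shift (tri k) g n) ∎

  -- Generating functions: each coordinate x contributes a monomial of degree `tri x`, and summing
  -- over the coordinates one at a time produces one factor each.
  ∑-tuples : ∀ b k m → ∑ (tuples b k) (λ xs → δ (sum (map tri xs)) m) ≡ (ψ-below (suc b) ^⊛ k) m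
  ∑-tuples b zero    m = ℤₚ.+-identityʳ (one m)
  ∑-tuples b (suc k) m = begin
    ∑ (concatMap (λ x → map (x ∷_) (tuples b k)) (upTo (suc b))) f
      ≡⟨ ∑-concatMap (λ x → map (x ∷_) (tuples b k)) (upTo (suc b)) f ⟩
    ∑ (upTo (suc b)) (λ x → ∑ (map (x ∷_) (tuples b k)) f)
      ≡⟨ ∑-cong (upTo (suc b)) (λ {x} _ → inner x) ⟩
    ∑ (upTo (suc b)) (λ x → (δ (tri x) ⊛ P) m)
      ≡⟨ sym (∑⊛ (upTo (suc b)) (λ x → δ (tri x)) P m) ⟩
    (ψ-below (suc b) ⊛ P) m ∎
    where
    f = λ xs → δ (sum (map tri xs)) m
    P = ψ-below (suc b) ^⊛ k
    inner : ∀ x → ∑ (map (x ∷_) (tuples b k)) f ≡ (δ (tri x) ⊛ P) m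
    inner x = begin
      ∑ (map (x ∷_) (tuples b k)) f
        ≡⟨ ∑-map (x ∷_) (tuples b k) f ⟩
      ∑ (tuples b k) (λ ys → δ (tri x ℕ.+ sum (map tri ys)) m)
        ≡⟨ ∑-cong (tuples b k) (λ {ys} _ → shift-+ (tri x) (sum (map tri ys)) one m) ⟩
      ∑ (tuples b k) (λ ys → shift (tri x) (δ (sum (map tri ys))) m)
        ≡⟨ shift-∑ (tri x) (tuples b k) (λ ys → δ (sum (map tri ys))) m ⟩
      shift (tri x) (λ i → ∑ (tuples b k) (λ ys → δ (sum (map tri ys)) i)) m
        ≡⟨ shift-cong (tri x) (λ i → trans (∑-tuples b k i) (sym (one⊛ P i))) m ⟩
      shift (tri x) (one ⊛ P) m
        ≡⟨ sym (shift⊛ (tri x) one P m) ⟩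
      (δ (tri x) ⊛ P) m ∎

  t6≡ψ^6 : ∀ m → + t6 m ≡ (ψ ^⊛ 6) m
  t6≡ψ^6 m = begin
    + t6 m
      ≡⟨ length-filter-≟ (λ xs → sum (map tri xs)) m (tuples m 6) ⟩
    ∑ (tuples m 6) (λ xs → δ (sum (map tri xs)) m)
      ≡⟨ ∑-tuples m 6 m ⟩
    (ψ-below (suc m) ^⊛ 6) m
      ≡⟨ ^⊛-cong-≤ 6 m (λ i≤m → ψ-below≡ψ (s≤s i≤m)) ⟩
    (ψ ^⊛ 6) m ∎

  -- Characters modulo 4

  -- The 4-periodic function on ℤ with values a, b, c, d at 0, 1, 2, 3.
  cyc : ℤ → ℤ → ℤ → ℤ → ℤ → ℤ
  cyc a b c d (+ zero)      = a
  cyc a b c d (+ suc n)     = cyc b c d a (+ n)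
  cyc a b c d -[1+ zero ]   = d
  cyc a b c d -[1+ suc n ]  = cyc d a b c -[1+ n ]

  cyc-suc : ∀ a b c d i → cyc a b c d (1ℤ + i) ≡ cyc b c d a i
  cyc-suc a b c d (+ n)          = refl
  cyc-suc a b c d -[1+ zero ]    = refl
  cyc-suc a b c d -[1+ suc n ]   = refl

  cyc-neg : ∀ a b c d i → cyc a b c d (- i) ≡ cyc a d c b i
  cyc-neg a b c d (+ zero)              = refl
  cyc-neg a b c d (+ suc zero)          = refl
  cyc-neg a b c d (+ suc (suc n))       = cyc-neg d a b c (+ suc n)
  cyc-neg a b c d -[1+ zero ]           = refl
  cyc-neg a b c d -[1+ suc n ]          = cyc-neg b c d a -[1+ n ]

  cyc-map-neg : ∀ a b c d i → cyc (- a) (- b) (- c) (- d) i ≡ - cyc a b c d i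
  cyc-map-neg a b c d (+ zero)      = refl
  cyc-map-neg a b c d (+ suc n)     = cyc-map-neg b c d a (+ n)
  cyc-map-neg a b c d -[1+ zero ]   = refl
  cyc-map-neg a b c d -[1+ suc n ]  = cyc-map-neg d a b c -[1+ n ]

  periodic : ∀ (f : ℤ → ℤ) p → (∀ i → f (p + i) ≡ f i) → ∀ q i → f (p * q + i) ≡ f i
  periodic f p per (+ n) i = up n
    where
    lem : ∀ p n i → p * (1ℤ + n) + i ≡ p + (p * n + i)
    lem = solve-∀
    up : ∀ n → f (p * + n + i) ≡ f i
    up zero    = cong f (trans (cong (_+ i) (ℤₚ.*-zeroʳ p)) (ℤₚ.+-identityˡ i))
    up (suc n) = trans (cong f (lem p (+ n) i)) (trans (per _) (up n))
  periodic f p per -[1+ n ] i =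
    trans (sym (periodic f p per (+ suc n) _)) (cong f (lem p (+ suc n) i))
    where
    lem : ∀ p n i → p * n + (p * (- n) + i) ≡ i
    lem = solve-∀

  -- χ is the odd character modulo 4, κ(d) is (-1)^(d/2) for even d, and η indicates evenness. The
  -- zero values encode the parity conditions, so that sums may run over all solutions.
  χ κ η : ℤ → ℤ
  χ = cyc 0ℤ 1ℤ 0ℤ -1ℤ
  κ = cyc 1ℤ 0ℤ -1ℤ 0ℤ
  η = cyc 1ℤ 0ℤ 1ℤ 0ℤ

  cyc-4periodic : ∀ a b c d q i → cyc a b c d (+ 4 * q + i) ≡ cyc a b c d i
  cyc-4periodic a b c d = periodic (cyc a b c d) (+ 4) λ i →
    trans (cong (cyc a b c d) (lem i))
          (trans (cyc-suc a b c d (1ℤ + (1ℤ + (1ℤ + i)))) (trans (cyc-suc b c d a (1ℤ + (1ℤ + i)))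
            (trans (cyc-suc c d a b (1ℤ + i)) (cyc-suc d a b c i))))
    where
    lem : ∀ i → + 4 + i ≡ 1ℤ + (1ℤ + (1ℤ + (1ℤ + i)))
    lem = solve-∀

  η-2periodic : ∀ q i → η (+ 2 * q + i) ≡ η i
  η-2periodic = periodic η (+ 2) λ i →
    trans (cong η (lem i)) (trans (cyc-suc 1ℤ 0ℤ 1ℤ 0ℤ (1ℤ + i)) (cyc-suc 0ℤ 1ℤ 0ℤ 1ℤ i))
    where
    lem : ∀ i → + 2 + i ≡ 1ℤ + (1ℤ + i)
    lem = solve-∀

  η-double : ∀ i → η (+ 2 * i) ≡ 1ℤ
  η-double i = trans (cong η (sym (ℤₚ.+-identityʳ (+ 2 * i)))) (η-2periodic i 0ℤ)

  χ-neg : ∀ i → χ (- i) ≡ - χ i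
  χ-neg i = trans (cyc-neg 0ℤ 1ℤ 0ℤ -1ℤ i) (cyc-map-neg 0ℤ 1ℤ 0ℤ -1ℤ i)

  χ-reflect : ∀ q i → χ (+ 4 * q - i) ≡ - χ i
  χ-reflect q i = trans (cyc-4periodic _ _ _ _ q (- i)) (χ-neg i)

  κ-neg : ∀ i → κ (- i) ≡ κ i
  κ-neg = cyc-neg _ _ _ _

  κ-2shift : ∀ i → κ (+ 2 + i) ≡ - κ i
  κ-2shift i = trans (cong κ (lem i))
    (trans (cyc-suc _ _ _ _ (1ℤ + i)) (trans (cyc-suc _ _ _ _ i) (cyc-map-neg 1ℤ 0ℤ -1ℤ 0ℤ i)))
    where
    lem : ∀ i → + 2 + i ≡ 1ℤ + (1ℤ + i)
    lem = solve-∀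

  κ-reflect : ∀ q i → κ (+ 4 * q + - (+ 2 + i)) ≡ - κ i
  κ-reflect q i = trans (cyc-4periodic _ _ _ _ q (- (+ 2 + i))) (trans (κ-neg (+ 2 + i)) (κ-2shift i))

  data Residue : ℤ → Set where
    r0 : ∀ q → Residue (+ 4 * q + + 0)
    r1 : ∀ q → Residue (+ 4 * q + + 1)
    r2 : ∀ q → Residue (+ 4 * q + + 2)
    r3 : ∀ q → Residue (+ 4 * q + + 3)

  residue : ∀ i → Residue i
  residue i = subst Residue (sym (trans (a≡a%ℕn+[a/ℕn]*n i 4) (lem (+ (i %ℕ 4)) (i /ℕ 4))))
                    (pick (i %ℕ 4) (i /ℕ 4) (n%ℕd<d i 4))
    where
    lem : ∀ r q → r + q * + 4 ≡ + 4 * q + r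
    lem = solve-∀
    pick : ∀ r q → r ℕ.< 4 → Residue (+ 4 * q + + r)
    pick 0 q _ = r0 q
    pick 1 q _ = r1 q
    pick 2 q _ = r2 q
    pick 3 q _ = r3 q
    pick (suc (suc (suc (suc r)))) q (s≤s (s≤s (s≤s (s≤s ()))))

  parity : ∀ i → (∃ λ g → i ≡ + 2 * g) ⊎ (η i ≡ 0ℤ × κ i ≡ 0ℤ)
  parity i with residue i
  ... | r0 q = inj₁ (+ 2 * q , lem q)
    where
    lem : ∀ q → + 4 * q + + 0 ≡ + 2 * (+ 2 * q)
    lem = solve-∀
  ... | r1 q = inj₂ (cyc-4periodic _ _ _ _ q (+ 1) , cyc-4periodic _ _ _ _ q (+ 1))
  ... | r2 q = inj₁ (+ 2 * q + + 1 , lem q)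
    where
    lem : ∀ q → + 4 * q + + 2 ≡ + 2 * (+ 2 * q + + 1)
    lem = solve-∀
  ... | r3 q = inj₂ (cyc-4periodic _ _ _ _ q (+ 3) , cyc-4periodic _ _ _ _ q (+ 3))

  -- One factor is 1 and the other 3 modulo 4. The fourteen other pairs of residues are excluded by
  -- applying χ to the product, which must give -1.
  product≡3 : ∀ d e t → d * e ≡ + 4 * t + + 3 → χ e ≡ - χ d × ∃ λ h → e ≡ + 2 * h + 1ℤ
  product≡3 d e t eq = go (residue d) (residue e) eq
    where
    χr : ∀ q r → χ (+ 4 * q + r) ≡ χ r
    χr = cyc-4periodic _ _ _ _
    expand : ∀ q r q′ r′ → (+ 4 * q + r) * (+ 4 * q′ + r′) ≡ + 4 * (+ 4 * q * q′ + q * r′ + r * q′) + r * r′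
    expand = solve-∀
    absurd : ∀ {A : Set} q r q′ r′ → χ (r * r′) ≢ -1ℤ →
             (+ 4 * q + r) * (+ 4 * q′ + r′) ≡ + 4 * t + + 3 → A
    absurd q r q′ r′ ne eq = contradiction
      (trans (sym (trans (cong χ (expand q r q′ r′)) (χr (+ 4 * q * q′ + q * r′ + r * q′) (r * r′))))
             (trans (cong χ eq) (χr t (+ 3)))) ne
    odd₁ : ∀ q → + 4 * q + + 1 ≡ + 2 * (+ 2 * q) + 1ℤ
    odd₁ = solve-∀
    odd₃ : ∀ q → + 4 * q + + 3 ≡ + 2 * (+ 2 * q + 1ℤ) + 1ℤ
    odd₃ = solve-∀
    go : ∀ {d e} → Residue d → Residue e → d * e ≡ + 4 * t + + 3 → χ e ≡ - χ d × ∃ λ h → e ≡ + 2 * h + 1ℤ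
    go (r1 q) (r3 q′) eq = trans (χr q′ (+ 3)) (cong -_ (sym (χr q (+ 1)))) , + 2 * q′ + 1ℤ , odd₃ q′
    go (r3 q) (r1 q′) eq = trans (χr q′ (+ 1)) (cong -_ (sym (χr q (+ 3)))) , + 2 * q′ , odd₁ q′
    go (r0 q) (r0 q′) eq = absurd q (+ 0) q′ (+ 0) (λ ()) eq
    go (r0 q) (r1 q′) eq = absurd q (+ 0) q′ (+ 1) (λ ()) eq
    go (r0 q) (r2 q′) eq = absurd q (+ 0) q′ (+ 2) (λ ()) eq
    go (r0 q) (r3 q′) eq = absurd q (+ 0) q′ (+ 3) (λ ()) eq
    go (r1 q) (r0 q′) eq = absurd q (+ 1) q′ (+ 0) (λ ()) eq
    go (r1 q) (r1 q′) eq = absurd q (+ 1) q′ (+ 1) (λ ()) eq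
    go (r1 q) (r2 q′) eq = absurd q (+ 1) q′ (+ 2) (λ ()) eq
    go (r2 q) (r0 q′) eq = absurd q (+ 2) q′ (+ 0) (λ ()) eq
    go (r2 q) (r1 q′) eq = absurd q (+ 2) q′ (+ 1) (λ ()) eq
    go (r2 q) (r2 q′) eq = absurd q (+ 2) q′ (+ 2) (λ ()) eq
    go (r2 q) (r3 q′) eq = absurd q (+ 2) q′ (+ 3) (λ ()) eq
    go (r3 q) (r0 q′) eq = absurd q (+ 3) q′ (+ 0) (λ ()) eq
    go (r3 q) (r2 q′) eq = absurd q (+ 3) q′ (+ 2) (λ ()) eq
    go (r3 q) (r3 q′) eq = absurd q (+ 3) q′ (+ 3) (λ ()) eq

  -- Solutions of 2x(x+1) + de = N

  Positive : ℤ → Set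
  Positive i = ∃ λ a → i ≡ +[1+ a ]

  integers positives : ℕ → List ℤ
  integers  K = map +_ (upTo K) ++ map -[1+_] (upTo K)
  positives K = map +[1+_] (upTo K)

  -- Not the absolute value: -[1+ k ] is -1 - k, which has the same x(x+1) as k. Thus `mag` is the
  -- natural number belonging to the same triangular number.
  mag : ℤ → ℕ
  mag (+ k)    = k
  mag -[1+ k ] = k

  ∈-integers : ∀ {K} x → mag x < K → x ∈ integers K
  ∈-integers (+ k)    p = ∈-++⁺ˡ (∈-map⁺ +_ (∈-upTo⁺ p))
  ∈-integers {K} -[1+ k ] p = ∈-++⁺ʳ (map +_ (upTo K)) (∈-map⁺ -[1+_] (∈-upTo⁺ p))

  integers-unique : ∀ K → Unique (integers K)
  integers-unique K = Unique.++⁺ (Unique.map⁺ ℤₚ.+-injective (Unique.upTo⁺ K))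
                                 (Unique.map⁺ ℤₚ.-[1+-injective (Unique.upTo⁺ K)) disjoint
    where
    disjoint : ∀ {x} → ¬ (x ∈ map +_ (upTo K) × x ∈ map -[1+_] (upTo K))
    disjoint (p , q) with _ , _ , refl ← ∈-map⁻ +_ p | _ , _ , () ← ∈-map⁻ -[1+_] q

  positives-unique : ∀ K → Unique (positives K)
  positives-unique K = Unique.map⁺ (λ { refl → refl }) (Unique.upTo⁺ K)

  ∈-positives : ∀ {K a} → a < K → +[1+ a ] ∈ positives K
  ∈-positives p = ∈-map⁺ +[1+_] (∈-upTo⁺ p)

  ∈-positives⁻ : ∀ {K x} → x ∈ positives K → Positive x
  ∈-positives⁻ p with a , _ , eq ← ∈-map⁻ +[1+_] p = a , eq

  pairBox : ℕ → List (ℤ × ℤ)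
  pairBox K = cartesianProduct (positives K) (positives K)

  pairBox-unique : ∀ K → Unique (pairBox K)
  pairBox-unique K = Unique.cartesianProduct⁺ (positives-unique K) (positives-unique K)

  ∈-pairBox : ∀ {K a b} → a < K → b < K → (+[1+ a ] , +[1+ b ]) ∈ pairBox K
  ∈-pairBox p q = ∈-cartesianProduct⁺ (∈-positives p) (∈-positives q)

  ∈-pairBox⁻ : ∀ K {d e} → (d , e) ∈ pairBox K → Positive d × Positive e
  ∈-pairBox⁻ K p with q , r ← ∈-cartesianProduct⁻ (positives K) (positives K) p = ∈-positives⁻ q , ∈-positives⁻ r

  quad : ℤ → ℤ
  quad x = + 2 * (x * (x + 1ℤ))

  quad≡4tri : ∀ x → quad x ≡ + 4 * + tri (mag x)
  quad≡4tri (+ k) = begin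
    + 2 * (+ k * (+ k + 1ℤ))  ≡⟨ cong (λ z → + 2 * (+ k * z)) (ℤₚ.+-comm (+ k) 1ℤ) ⟩
    + 2 * (+ k * + suc k)     ≡⟨ cong (+ 2 *_) (sym (ℤₚ.pos-* k (suc k))) ⟩
    + 2 * + (k ℕ.* suc k)     ≡⟨ cong (λ z → + 2 * + z) (sym (2*tri k)) ⟩
    + 2 * + (tri k ℕ.* 2)     ≡⟨ cong (+ 2 *_) (ℤₚ.pos-* (tri k) 2) ⟩
    + 2 * (+ tri k * + 2)     ≡⟨ lem (+ tri k) ⟩
    + 4 * + tri k             ∎
    where
    lem : ∀ a → + 2 * (a * + 2) ≡ + 4 * a
    lem = solve-∀
  quad≡4tri -[1+ k ] = trans (lem (+ k)) (quad≡4tri (+ k))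
    where
    lem : ∀ y → + 2 * (- (1ℤ + y) * (- (1ℤ + y) + 1ℤ)) ≡ + 2 * (y * (y + 1ℤ))
    lem = solve-∀

  IsSolution : ℕ → ℤ → ℤ → ℤ → Set
  IsSolution N x d e = Positive d × Positive e × quad x + d * e ≡ + N

  solution⇒ℕ : ∀ {N} x a b → quad x + +[1+ a ] * +[1+ b ] ≡ + N → 4 ℕ.* tri (mag x) ℕ.+ suc a ℕ.* suc b ≡ N
  solution⇒ℕ {N} x a b eq = ℤₚ.+-injective (begin
    + (4 ℕ.* tri (mag x) ℕ.+ suc a ℕ.* suc b)
      ≡⟨ ℤₚ.pos-+ (4 ℕ.* tri (mag x)) (suc a ℕ.* suc b) ⟩
    + (4 ℕ.* tri (mag x)) + + (suc a ℕ.* suc b)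
      ≡⟨ cong₂ _+_ (trans (ℤₚ.pos-* 4 (tri (mag x))) (sym (quad≡4tri x))) (ℤₚ.pos-* (suc a) (suc b)) ⟩
    quad x + +[1+ a ] * +[1+ b ]
      ≡⟨ eq ⟩
    + N ∎)

  ℕ⇒solution : ∀ {N} x a b → 4 ℕ.* tri (mag x) ℕ.+ suc a ℕ.* suc b ≡ N → quad x + +[1+ a ] * +[1+ b ] ≡ + N
  ℕ⇒solution x a b refl = sym (trans (ℤₚ.pos-+ (4 ℕ.* tri (mag x)) (suc a ℕ.* suc b))
    (cong₂ _+_ (trans (ℤₚ.pos-* 4 (tri (mag x))) (sym (quad≡4tri x))) (ℤₚ.pos-* (suc a) (suc b))))

  factorˡ-≤ : ∀ a b {N} → suc a ℕ.* suc b ≤ N → a < suc N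
  factorˡ-≤ a b p = ℕₚ.m≤n⇒m≤1+n (ℕₚ.≤-trans (ℕₚ.m≤m*n (suc a) (suc b)) p)

  factorʳ-≤ : ∀ a b {N} → suc a ℕ.* suc b ≤ N → b < suc N
  factorʳ-≤ a b p = ℕₚ.m≤n⇒m≤1+n (ℕₚ.≤-trans (ℕₚ.m≤n*m (suc b) (suc a)) p)

  Triple : Set
  Triple = ℤ × ℤ × ℤ

  solution? : ∀ N → (z : Triple) → Dec (quad (proj₁ z) + proj₁ (proj₂ z) * proj₂ (proj₂ z) ≡ + N)
  solution? N (x , d , e) = quad x + d * e ℤₚ.≟ + N

  solutions : ℕ → List Triple
  solutions N = filter (solution? N) (cartesianProduct (integers (suc N)) (pairBox (suc N)))

  solutions-unique : ∀ N → Unique (solutions N)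
  solutions-unique N = Unique.filter⁺ (solution? N)
    (Unique.cartesianProduct⁺ (integers-unique (suc N)) (pairBox-unique (suc N)))

  ∈-solutions⁻ : ∀ N {x d e} → (x , d , e) ∈ solutions N → IsSolution N x d e
  ∈-solutions⁻ N p with q , eq ← ∈-filter⁻ (solution? N) p
                     with _ , r ← ∈-cartesianProduct⁻ (integers (suc N)) (pairBox (suc N)) q
                     with d , e ← ∈-pairBox⁻ (suc N) r = d , e , eq

  -- The box loses nothing: de ≤ N bounds d and e, and `mag x` ≤ `tri (mag x)` ≤ N bounds x.
  ∈-solutions⁺ : ∀ {N x d e} → IsSolution N x d e → (x , d , e) ∈ solutions N
  ∈-solutions⁺ {N} {x} ((a , refl) , (b , refl) , eq) =
    ∈-filter⁺ (solution? N) (∈-cartesianProduct⁺ (∈-integers x x<) (∈-pairBox (factorˡ-≤ a b ab≤) (factorʳ-≤ a b ab≤))) eq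
    where
    eqℕ = solution⇒ℕ x a b eq
    ab≤ : suc a ℕ.* suc b ≤ N
    ab≤ = subst (suc a ℕ.* suc b ≤_) eqℕ (ℕₚ.m≤n+m _ (4 ℕ.* tri (mag x)))
    x< : mag x < suc N
    x< = s≤s (ℕₚ.≤-trans (n≤tri (mag x)) (ℕₚ.≤-trans (ℕₚ.m≤n*m (tri (mag x)) 4)
           (subst (4 ℕ.* tri (mag x) ≤_) eqℕ (ℕₚ.m≤m+n _ (suc a ℕ.* suc b)))))

  -- Factorizations, and solutions with x fixed

  pair? : ∀ N → (p : ℤ × ℤ) → Dec (proj₁ p * proj₂ p ≡ + N)
  pair? N (d , e) = d * e ℤₚ.≟ + N

  factorizations : ℕ → List (ℤ × ℤ)
  factorizations N = filter (pair? N) (pairBox (suc N))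

  factorizations-unique : ∀ N → Unique (factorizations N)
  factorizations-unique N = Unique.filter⁺ (pair? N) (pairBox-unique (suc N))

  ∈-factorizations⁻ : ∀ N {d e} → (d , e) ∈ factorizations N →
                      ∃₂ λ a b → d ≡ +[1+ a ] × e ≡ +[1+ b ] × suc a ℕ.* suc b ≡ N
  ∈-factorizations⁻ N p with q , eq ← ∈-filter⁻ (pair? N) p
                          with (a , refl) , (b , refl) ← ∈-pairBox⁻ (suc N) q =
    a , b , refl , refl , ℤₚ.+-injective (trans (ℤₚ.pos-* (suc a) (suc b)) eq)

  ∈-factorizations⁺ : ∀ {N} a b → suc a ℕ.* suc b ≡ N → (+[1+ a ] , +[1+ b ]) ∈ factorizations N
  ∈-factorizations⁺ {N} a b refl = ∈-filter⁺ (pair? N)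
    (∈-pairBox (factorˡ-≤ a b ℕₚ.≤-refl) (factorʳ-≤ a b ℕₚ.≤-refl)) (sym (ℤₚ.pos-* (suc a) (suc b)))

  -- The index is 4m + r because `quad x` = 4T with T triangular: fixing x in the equation for 4n +
  -- r leaves the factorizations of 4(n - T) + r.
  divisorSeries : ℕ → (ℤ → ℤ → ℤ) → Series
  divisorSeries r v m = ∑ (factorizations (4 ℕ.* m ℕ.+ r)) (λ (d , e) → v d e)

  module _ (n r : ℕ) (r<4 : r < 4) (v : ℤ → ℤ → ℤ) where
    private
      N = 4 ℕ.* n ℕ.+ r
      K = suc N

    -- For T > n there is no solution, since r < 4 gives 4n + r < 4T; this agrees with the zeros
    -- that `shift` puts below its degree.
    fibre : ∀ x → ∑ (filter (λ y → solution? N (x , y)) (pairBox K)) (λ (d , e) → v d e) ≡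
                  shift (tri (mag x)) (divisorSeries r v) n
    fibre x = case (ℕₚ.≤-<-connex T n) of λ
      { (inj₁ T≤n) → trans (∑-set-cong (Unique.filter⁺ P? (pairBox-unique K)) (factorizations-unique (4 ℕ.* (n ∸ T) ℕ.+ r))
                                        (to T≤n) (from T≤n) _)
                           (sym (shift-≤ (divisorSeries r v) T≤n))
      ; (inj₂ n<T) → trans (∑-zero (filter P? (pairBox K)) (λ p → contradiction p (empty n<T)))
                           (sym (shift-> (divisorSeries r v) n<T)) }
      where
      T = tri (mag x)
      P? = λ y → solution? N (x , y)
      split : T ≤ n → N ≡ 4 ℕ.* T ℕ.+ (4 ℕ.* (n ∸ T) ℕ.+ r)
      split T≤n = begin
        4 ℕ.* n ℕ.+ r                         ≡⟨ cong (λ z → 4 ℕ.* z ℕ.+ r) (sym (ℕₚ.m+[n∸m]≡n T≤n)) ⟩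
        4 ℕ.* (T ℕ.+ (n ∸ T)) ℕ.+ r           ≡⟨ cong (ℕ._+ r) (ℕₚ.*-distribˡ-+ 4 T (n ∸ T)) ⟩
        4 ℕ.* T ℕ.+ 4 ℕ.* (n ∸ T) ℕ.+ r       ≡⟨ ℕₚ.+-assoc (4 ℕ.* T) _ r ⟩
        4 ℕ.* T ℕ.+ (4 ℕ.* (n ∸ T) ℕ.+ r)     ∎
      to : T ≤ n → ∀ {y} → y ∈ filter P? (pairBox K) → y ∈ factorizations (4 ℕ.* (n ∸ T) ℕ.+ r)
      to T≤n p with q , eq ← ∈-filter⁻ P? p with (a , refl) , (b , refl) ← ∈-pairBox⁻ K q =
        ∈-factorizations⁺ a b (ℕₚ.+-cancelˡ-≡ (4 ℕ.* T) _ _ (trans (solution⇒ℕ x a b eq) (split T≤n)))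
      from : T ≤ n → ∀ {y} → y ∈ factorizations (4 ℕ.* (n ∸ T) ℕ.+ r) → y ∈ filter P? (pairBox K)
      from T≤n {d , e} p with a , b , refl , refl , eq ← ∈-factorizations⁻ (4 ℕ.* (n ∸ T) ℕ.+ r) p =
        ∈-filter⁺ P? (∈-pairBox (factorˡ-≤ a b ab≤) (factorʳ-≤ a b ab≤))
                     (ℕ⇒solution x a b (trans (cong (4 ℕ.* T ℕ.+_) eq) (sym (split T≤n))))
        where
        ab≤ : suc a ℕ.* suc b ≤ N
        ab≤ = subst₂ _≤_ (sym eq) (sym (split T≤n)) (ℕₚ.m≤n+m _ (4 ℕ.* T))
      empty : n < T → ∀ {y} → ¬ y ∈ filter P? (pairBox K)
      empty n<T p with q , eq ← ∈-filter⁻ P? p with (a , refl) , (b , refl) ← ∈-pairBox⁻ K q =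
        ℕₚ.<-irrefl refl (ℕₚ.<-≤-trans
          (ℕₚ.≤-<-trans (ℕₚ.≤-reflexive (solution⇒ℕ x a b eq)) (ℕₚ.+-monoʳ-< (4 ℕ.* n) r<4))
          (ℕₚ.≤-trans (ℕₚ.≤-reflexive (trans (ℕₚ.+-comm (4 ℕ.* n) 4) (sym (ℕₚ.*-suc 4 n))))
                      (ℕₚ.≤-trans (ℕₚ.*-monoʳ-≤ 4 n<T) (ℕₚ.m≤m+n (4 ℕ.* T) (suc a ℕ.* suc b)))))

    -- The bridge from solutions to power series. Each triangular number arises from the two values
    -- x = k and x = -1 - k, whence the sum of two values of U.
    ∑-solutions : ∀ (U : ℤ → ℤ) → ∑ (solutions N) (λ (x , d , e) → U x * v d e) ≡
      ∑ (upTo K) (λ k → (U (+ k) + U -[1+ k ]) * shift (tri k) (divisorSeries r v) n)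
    ∑-solutions U = begin
      ∑ (solutions N) (λ (x , d , e) → U x * v d e)
        ≡⟨ ∑-filter-cartesianProduct (solution? N) (integers K) (pairBox K) (λ (x , d , e) → U x * v d e) ⟩
      ∑ (integers K) (λ x → ∑ (F x) (λ (d , e) → U x * v d e))
        ≡⟨ ∑-cong (integers K) (λ {x} _ → trans (∑-distribˡ-* (F x) (U x) (λ (d , e) → v d e)) (cong (U x *_) (fibre x))) ⟩
      ∑ (integers K) (λ x → U x * S (mag x))
        ≡⟨ ∑-++ (map +_ (upTo K)) (map -[1+_] (upTo K)) (λ x → U x * S (mag x)) ⟩
      ∑ (map +_ (upTo K)) (λ x → U x * S (mag x)) + ∑ (map -[1+_] (upTo K)) (λ x → U x * S (mag x))
        ≡⟨ cong₂ _+_ (∑-map +_ (upTo K) (λ x → U x * S (mag x))) (∑-map -[1+_] (upTo K) (λ x → U x * S (mag x))) ⟩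
      ∑ (upTo K) (λ k → U (+ k) * S k) + ∑ (upTo K) (λ k → U -[1+ k ] * S k)
        ≡⟨ sym (∑-distrib-+ (upTo K) (λ k → U (+ k) * S k) (λ k → U -[1+ k ] * S k)) ⟩
      ∑ (upTo K) (λ k → U (+ k) * S k + U -[1+ k ] * S k)
        ≡⟨ ∑-cong (upTo K) (λ {k} _ → sym (ℤₚ.*-distribʳ-+ (S k) (U (+ k)) (U -[1+ k ]))) ⟩
      ∑ (upTo K) (λ k → (U (+ k) + U -[1+ k ]) * S k) ∎
      where
      S = λ k → shift (tri k) (divisorSeries r v) n
      F = λ x → filter (λ y → solution? N (x , y)) (pairBox K)

  -- The involution

  -- For X = 2x + 1 the condition reads X² + 2de = 2N + 1, and s = X + d.
  s t u : ℤ → ℤ → ℤ → ℤ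
  s x d e = + 2 * x + 1ℤ + d
  t x d e = e - + 2 * (+ 2 * x + 1ℤ + d)
  u x d e = + 2 * e - + 2 * (+ 2 * x + 1ℤ) - d

  -- In terms of X the three moves are X ↦ -X - 2d, X ↦ 3X + 2d - 2e and X ↦ 2e - X; the last two
  -- keep s. The signs of t and u are arguments, so that knowing their values is enough to compute
  -- `φ`.
  step : Triple → ℤ → ℤ → Triple
  step (x , d , e) +[1+ _ ] _        = - x - 1ℤ - d , d , t x d e
  step (x , d , e) +0       _        = x , d , e
  step (x , d , e) -[1+ _ ] +[1+ _ ] = + 3 * x + 1ℤ + d - e , u x d e , - t x d e
  step (x , d , e) -[1+ _ ] +0       = x , d , e
  step (x , d , e) -[1+ _ ] -[1+ _ ] = e - x - 1ℤ , - u x d e , e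

  φ : Triple → Triple
  φ (x , d , e) = step (x , d , e) (t x d e) (u x d e)

  -- The clauses of `step` as equations; u is consulted only when t is negative.
  data Region (x d e : ℤ) : Set where
    reflected : ∀ {a}   → t x d e ≡ +[1+ a ] → Region x d e
    exchanged : ∀ {a b} → t x d e ≡ -[1+ a ] → u x d e ≡ +[1+ b ] → Region x d e
    flipped   : ∀ {a b} → t x d e ≡ -[1+ a ] → u x d e ≡ -[1+ b ] → Region x d e
    boundaryₜ : t x d e ≡ 0ℤ → Region x d e
    boundaryᵤ : ∀ {a} → t x d e ≡ -[1+ a ] → u x d e ≡ 0ℤ → Region x d e

  region : ∀ x d e → Region x d e
  region x d e = go (t x d e) (u x d e) refl refl
    where
    go : ∀ i j → t x d e ≡ i → u x d e ≡ j → Region x d e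
    go +[1+ _ ] _        p q = reflected p
    go +0       _        p q = boundaryₜ p
    go -[1+ _ ] +[1+ _ ] p q = exchanged p q
    go -[1+ _ ] +0       p q = boundaryᵤ p q
    go -[1+ _ ] -[1+ _ ] p q = flipped p q

  φ-reflected : ∀ x d e {a} → t x d e ≡ +[1+ a ] → φ (x , d , e) ≡ (- x - 1ℤ - d , d , t x d e)
  φ-reflected x d e p = cong (λ i → step (x , d , e) i (u x d e)) p

  φ-exchanged : ∀ x d e {a b} → t x d e ≡ -[1+ a ] → u x d e ≡ +[1+ b ] →
                φ (x , d , e) ≡ (+ 3 * x + 1ℤ + d - e , u x d e , - t x d e)
  φ-exchanged x d e p q = cong₂ (step (x , d , e)) p q

  φ-flipped : ∀ x d e {a b} → t x d e ≡ -[1+ a ] → u x d e ≡ -[1+ b ] →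
              φ (x , d , e) ≡ (e - x - 1ℤ , - u x d e , e)
  φ-flipped x d e p q = cong₂ (step (x , d , e)) p q

  φ-boundaryₜ : ∀ x d e → t x d e ≡ 0ℤ → φ (x , d , e) ≡ (x , d , e)
  φ-boundaryₜ x d e p = cong (λ i → step (x , d , e) i (u x d e)) p

  φ-boundaryᵤ : ∀ x d e {a} → t x d e ≡ -[1+ a ] → u x d e ≡ 0ℤ → φ (x , d , e) ≡ (x , d , e)
  φ-boundaryᵤ x d e p q = cong₂ (step (x , d , e)) p q

  triple-≡ : ∀ {x x′ d d′ e e′ : ℤ} → x ≡ x′ → d ≡ d′ → e ≡ e′ → (x , d , e) ≡ (x′ , d′ , e′)
  triple-≡ refl refl refl = refl

  -- Each region is mapped to itself because d and e are positive: at the image, t becomes e under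
  -- reflection and (t, u) becomes (-e, d) under exchange and (t, -d) under the flip. The same move
  -- is then applied again.
  φ-involutive : ∀ {x d e} → Positive d → Positive e → φ (φ (x , d , e)) ≡ (x , d , e)
  φ-involutive {x} {d} {e} (a , d≡) (b , e≡) = go (region x d e)
    where
    go : Region x d e → φ (φ (x , d , e)) ≡ (x , d , e)
    go (reflected p) = trans (cong φ (φ-reflected x d e p))
      (trans (φ-reflected (- x - 1ℤ - d) d (t x d e) (trans (e′ x d e) e≡))
             (triple-≡ (x′ x d) refl (e′ x d e)))
      where
      x′ : ∀ x d → - (- x - 1ℤ - d) - 1ℤ - d ≡ x
      x′ = solve-∀
      e′ : ∀ x d e → (e - + 2 * (+ 2 * x + 1ℤ + d)) - + 2 * (+ 2 * (- x - 1ℤ - d) + 1ℤ + d) ≡ e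
      e′ = solve-∀
    go (exchanged p q) = trans (cong φ (φ-exchanged x d e p q))
      (trans (φ-exchanged (+ 3 * x + 1ℤ + d - e) (u x d e) (- t x d e)
               (trans (t′ x d e) (cong -_ e≡)) (trans (d′ x d e) d≡))
             (triple-≡ (x′ x d e) (d′ x d e) (trans (cong -_ (t′ x d e)) (ℤₚ.neg-involutive e))))
      where
      x′ : ∀ x d e → + 3 * (+ 3 * x + 1ℤ + d - e) + 1ℤ + (+ 2 * e - + 2 * (+ 2 * x + 1ℤ) - d)
                     - (- (e - + 2 * (+ 2 * x + 1ℤ + d))) ≡ x
      x′ = solve-∀
      d′ : ∀ x d e → + 2 * (- (e - + 2 * (+ 2 * x + 1ℤ + d))) - + 2 * (+ 2 * (+ 3 * x + 1ℤ + d - e) + 1ℤ)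
                     - (+ 2 * e - + 2 * (+ 2 * x + 1ℤ) - d) ≡ d
      d′ = solve-∀
      t′ : ∀ x d e → - (e - + 2 * (+ 2 * x + 1ℤ + d))
                     - + 2 * (+ 2 * (+ 3 * x + 1ℤ + d - e) + 1ℤ + (+ 2 * e - + 2 * (+ 2 * x + 1ℤ) - d)) ≡ - e
      t′ = solve-∀
    go (flipped p q) = trans (cong φ (φ-flipped x d e p q))
      (trans (φ-flipped (e - x - 1ℤ) (- u x d e) e (trans (t′ x d e) p) (trans (d′ x d e) (cong -_ d≡)))
             (triple-≡ (x′ x e) (trans (cong -_ (d′ x d e)) (ℤₚ.neg-involutive d)) refl))
      where
      x′ : ∀ x e → e - (e - x - 1ℤ) - 1ℤ ≡ x
      x′ = solve-∀
      d′ : ∀ x d e → + 2 * e - + 2 * (+ 2 * (e - x - 1ℤ) + 1ℤ) - (- (+ 2 * e - + 2 * (+ 2 * x + 1ℤ) - d)) ≡ - d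
      d′ = solve-∀
      t′ : ∀ x d e → e - + 2 * (+ 2 * (e - x - 1ℤ) + 1ℤ + (- (+ 2 * e - + 2 * (+ 2 * x + 1ℤ) - d)))
                     ≡ e - + 2 * (+ 2 * x + 1ℤ + d)
      t′ = solve-∀
    go (boundaryₜ p)   = trans (cong φ (φ-boundaryₜ x d e p)) (φ-boundaryₜ x d e p)
    go (boundaryᵤ p q) = trans (cong φ (φ-boundaryᵤ x d e p q)) (φ-boundaryᵤ x d e p q)

  IsSol : ℕ → Triple → Set
  IsSol N (x , d , e) = IsSolution N x d e

  -- The sign conditions of a region say precisely that the new d and e are positive; the equation
  -- itself is preserved by a polynomial identity.
  φ-solution : ∀ {N} x d e → IsSolution N x d e → IsSol N (φ (x , d , e))
  φ-solution {N} x d e sol@(d⁺ , e⁺ , eq) = go (region x d e)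
    where
    go : Region x d e → IsSol N (φ (x , d , e))
    go (reflected p) = subst (IsSol N) (sym (φ-reflected x d e p)) (d⁺ , (_ , p) , trans (lem x d e) eq)
      where
      lem : ∀ x d e → + 2 * ((- x - 1ℤ - d) * ((- x - 1ℤ - d) + 1ℤ)) + d * (e - + 2 * (+ 2 * x + 1ℤ + d))
                      ≡ + 2 * (x * (x + 1ℤ)) + d * e
      lem = solve-∀
    go (exchanged p q) = subst (IsSol N) (sym (φ-exchanged x d e p q))
      ((_ , q) , (_ , cong -_ p) , trans (lem x d e) eq)
      where
      lem : ∀ x d e → + 2 * ((+ 3 * x + 1ℤ + d - e) * ((+ 3 * x + 1ℤ + d - e) + 1ℤ))
                      + (+ 2 * e - + 2 * (+ 2 * x + 1ℤ) - d) * - (e - + 2 * (+ 2 * x + 1ℤ + d))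
                      ≡ + 2 * (x * (x + 1ℤ)) + d * e
      lem = solve-∀
    go (flipped p q) = subst (IsSol N) (sym (φ-flipped x d e p q))
      ((_ , cong -_ q) , e⁺ , trans (lem x d e) eq)
      where
      lem : ∀ x d e → + 2 * ((e - x - 1ℤ) * ((e - x - 1ℤ) + 1ℤ)) + - (+ 2 * e - + 2 * (+ 2 * x + 1ℤ) - d) * e
                      ≡ + 2 * (x * (x + 1ℤ)) + d * e
      lem = solve-∀
    go (boundaryₜ p)   = subst (IsSol N) (sym (φ-boundaryₜ x d e p)) sol
    go (boundaryᵤ p q) = subst (IsSol N) (sym (φ-boundaryᵤ x d e p q)) sol

  module _ (N : ℕ) where

    ∑-symmetry : ∀ (h : Triple → Triple) → (∀ {x d e} → IsSolution N x d e → IsSol N (h (x , d , e))) →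
      (∀ {x d e} → IsSolution N x d e → h (h (x , d , e)) ≡ (x , d , e)) →
      ∀ f → ∑ (solutions N) (f ∘ h) ≡ ∑ (solutions N) f
    ∑-symmetry h sol inv = ∑-involution (solutions N) (solutions-unique N) h
      (λ p → ∈-solutions⁺ (sol (∈-solutions⁻ N p))) (λ p → inv (∈-solutions⁻ N p))

    ∑-φ : ∀ f → ∑ (solutions N) (f ∘ φ) ≡ ∑ (solutions N) f
    ∑-φ = ∑-symmetry φ (λ {x} {d} {e} → φ-solution x d e) (λ (d⁺ , e⁺ , _) → φ-involutive d⁺ e⁺)

    ∑-negate-x : ∀ f → ∑ (solutions N) (λ (x , d , e) → f (- x - 1ℤ , d , e)) ≡ ∑ (solutions N) f
    ∑-negate-x = ∑-symmetry (λ (x , d , e) → - x - 1ℤ , d , e)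
      (λ {x} {d} {e} (d⁺ , e⁺ , eq) → d⁺ , e⁺ , trans (lem₁ x d e) eq)
      (λ {x} _ → triple-≡ (lem₂ x) refl refl)
      where
      lem₁ : ∀ x d e → + 2 * ((- x - 1ℤ) * ((- x - 1ℤ) + 1ℤ)) + d * e ≡ + 2 * (x * (x + 1ℤ)) + d * e
      lem₁ = solve-∀
      lem₂ : ∀ x → - (- x - 1ℤ) - 1ℤ ≡ x
      lem₂ = solve-∀

    ∑-swap : ∀ f → ∑ (solutions N) (λ (x , d , e) → f (x , e , d)) ≡ ∑ (solutions N) f
    ∑-swap = ∑-symmetry (λ (x , d , e) → x , e , d)
      (λ {x} {d} {e} (d⁺ , e⁺ , eq) → e⁺ , d⁺ , trans (cong (_+_ (quad x)) (ℤₚ.*-comm e d)) eq) (λ _ → refl)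

  -- The sign-reversing weight for N = 4n + 3

  i≡-i⇒i≡0 : ∀ {i} → i ≡ - i → i ≡ 0ℤ
  i≡-i⇒i≡0 {+0} _ = refl

  ∑-neg : ∀ (xs : List A) f → ∑ xs (λ x → - f x) ≡ - ∑ xs f
  ∑-neg xs f = trans (∑-cong xs (λ {x} _ → sym (ℤₚ.-1*i≡-i (f x))))
                     (trans (∑-distribˡ-* xs -1ℤ f) (ℤₚ.-1*i≡-i (∑ xs f)))

  module _ (n : ℕ) where
    private
      N = 4 ℕ.* n ℕ.+ 3
      L = solutions N

    weight : Triple → ℤ
    weight (x , d , e) = χ d * ((+ 2 * x + 1ℤ + d) * (+ 2 * x + 1ℤ + d) * (+ 2 * x + 1ℤ + d) * (e - (+ 2 * x + 1ℤ)))

    product-mod-4 : ∀ x d e → IsSolution N x d e → d * e ≡ + 4 * (+ n - + tri (mag x)) + + 3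
    product-mod-4 x d e (_ , _ , eq) = begin
      d * e                                     ≡⟨ lem₁ (quad x) (d * e) ⟩
      (quad x + d * e) - quad x                 ≡⟨ cong₂ _-_ eq (quad≡4tri x) ⟩
      + N - + 4 * + tri (mag x)                 ≡⟨ cong (_- + 4 * + tri (mag x)) (trans (ℤₚ.pos-+ (4 ℕ.* n) 3) (cong (_+ + 3) (ℤₚ.pos-* 4 n))) ⟩
      + 4 * + n + + 3 - + 4 * + tri (mag x)     ≡⟨ lem₂ (+ n) (+ tri (mag x)) ⟩
      + 4 * (+ n - + tri (mag x)) + + 3         ∎
      where
      lem₁ : ∀ a b → b ≡ (a + b) - a
      lem₁ = solve-∀
      lem₂ : ∀ n a → + 4 * n + + 3 - + 4 * a ≡ + 4 * (n - a) + + 3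
      lem₂ = solve-∀

    χ-opposite : ∀ x d e → IsSolution N x d e → χ e ≡ - χ d × ∃ λ h → e ≡ + 2 * h + 1ℤ
    χ-opposite x d e sol = product≡3 d e (+ n - + tri (mag x)) (product-mod-4 x d e sol)

    swapped : ∀ x d e → IsSolution N x d e → IsSolution N x e d
    swapped x d e (d⁺ , e⁺ , eq) = e⁺ , d⁺ , trans (cong (_+_ (quad x)) (ℤₚ.*-comm e d)) eq

    -- Both e and X are odd, so 2e - 2X is a multiple of 4 and u is -d modulo 4.
    χ-u : ∀ x d e → IsSolution N x d e → χ (u x d e) ≡ - χ d
    χ-u x d e sol with _ , h , refl ← χ-opposite x d e sol = trans (cong χ (lem x d h)) (χ-reflect (h - x) d)
      where
      lem : ∀ x d h → + 2 * (+ 2 * h + 1ℤ) - + 2 * (+ 2 * x + 1ℤ) - d ≡ + 4 * (h - x) - d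
      lem = solve-∀

    odd≢even : ∀ h k → + 2 * h + 1ℤ ≢ + 2 * k
    odd≢even h k eq with () ← trans (sym (η-2periodic h 1ℤ)) (trans (cong η (trans eq (sym (ℤₚ.+-identityʳ (+ 2 * k))))) (η-2periodic k 0ℤ))

    -- Exactly one factor changes sign in each region: s³ under reflection, χ under exchange, e - X
    -- under the flip. The boundary is empty, as e = 2s or d = 2(e - X) would make an odd number
    -- even.
    weight-φ : ∀ x d e → IsSolution N x d e → weight (φ (x , d , e)) ≡ - weight (x , d , e)
    weight-φ x d e sol = go (region x d e)
      where
      go : Region x d e → weight (φ (x , d , e)) ≡ - weight (x , d , e)
      go (reflected p) = trans (cong weight (φ-reflected x d e p)) (lem (χ d) x d e)
        where
        lem : ∀ c x d e → c * ((+ 2 * (- x - 1ℤ - d) + 1ℤ + d) * (+ 2 * (- x - 1ℤ - d) + 1ℤ + d) * (+ 2 * (- x - 1ℤ - d) + 1ℤ + d)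
                               * ((e - + 2 * (+ 2 * x + 1ℤ + d)) - (+ 2 * (- x - 1ℤ - d) + 1ℤ)))
                          ≡ - (c * ((+ 2 * x + 1ℤ + d) * (+ 2 * x + 1ℤ + d) * (+ 2 * x + 1ℤ + d) * (e - (+ 2 * x + 1ℤ))))
        lem = solve-∀
      go (exchanged p q) = trans (cong weight (φ-exchanged x d e p q))
        (trans (cong₂ _*_ (χ-u x d e sol) (cong₂ (λ a b → a * a * a * b) (lem₁ x d e) (lem₂ x d e)))
               (sym (ℤₚ.neg-distribˡ-* (χ d) ((+ 2 * x + 1ℤ + d) * (+ 2 * x + 1ℤ + d) * (+ 2 * x + 1ℤ + d) * (e - (+ 2 * x + 1ℤ))))))
        where
        lem₁ : ∀ x d e → + 2 * (+ 3 * x + 1ℤ + d - e) + 1ℤ + (+ 2 * e - + 2 * (+ 2 * x + 1ℤ) - d) ≡ + 2 * x + 1ℤ + d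
        lem₁ = solve-∀
        lem₂ : ∀ x d e → - (e - + 2 * (+ 2 * x + 1ℤ + d)) - (+ 2 * (+ 3 * x + 1ℤ + d - e) + 1ℤ) ≡ e - (+ 2 * x + 1ℤ)
        lem₂ = solve-∀
      go (flipped p q) = trans (cong weight (φ-flipped x d e p q))
        (trans (cong₂ _*_ (trans (χ-neg (u x d e)) (trans (cong -_ (χ-u x d e sol)) (ℤₚ.neg-involutive (χ d))))
                          (cong₂ (λ a b → a * a * a * b) (lem₁ x d e) (lem₂ x e)))
               (lem₃ (χ d) (+ 2 * x + 1ℤ + d) (e - (+ 2 * x + 1ℤ))))
        where
        lem₁ : ∀ x d e → + 2 * (e - x - 1ℤ) + 1ℤ + - (+ 2 * e - + 2 * (+ 2 * x + 1ℤ) - d) ≡ + 2 * x + 1ℤ + d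
        lem₁ = solve-∀
        lem₂ : ∀ x e → e - (+ 2 * (e - x - 1ℤ) + 1ℤ) ≡ - (e - (+ 2 * x + 1ℤ))
        lem₂ = solve-∀
        lem₃ : ∀ c a b → c * (a * a * a * - b) ≡ - (c * (a * a * a * b))
        lem₃ = solve-∀
      go (boundaryₜ p) with _ , h , refl ← χ-opposite x d e sol =
        contradiction (trans (lem h (+ 2 * x + 1ℤ + d)) (trans (cong (_+ + 2 * s x d e) p) (ℤₚ.+-identityˡ (+ 2 * s x d e))))
                      (odd≢even h (s x d e))
        where
        lem : ∀ h s → + 2 * h + 1ℤ ≡ ((+ 2 * h + 1ℤ) - + 2 * s) + + 2 * s
        lem = solve-∀
      go (boundaryᵤ p q) with _ , h , refl ← χ-opposite x e d (swapped x d e sol) =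
        contradiction (trans (lem h e x) (trans (cong (λ z → + 2 * (e - (+ 2 * x + 1ℤ)) - z) q) (ℤₚ.+-identityʳ (+ 2 * (e - (+ 2 * x + 1ℤ))))))
                      (odd≢even h (e - (+ 2 * x + 1ℤ)))
        where
        lem : ∀ h e x → + 2 * h + 1ℤ ≡ + 2 * (e - (+ 2 * x + 1ℤ)) - (+ 2 * e - + 2 * (+ 2 * x + 1ℤ) - (+ 2 * h + 1ℤ))
        lem = solve-∀

    -- The part of s³(e - X) even in X is d²(de - 3X²) - X²(X² - 3de). This is its first half,
    -- multiplied by χ(d); the second half is symmetric in d and e.
    moment : Triple → ℤ
    moment (x , d , e) = (d * e - + 3 * ((+ 2 * x + 1ℤ) * (+ 2 * x + 1ℤ))) * (χ d * (d * d))

    -- Averaging over x ↦ −1 − x keeps the part of the weight even in X, and exchanging d and e removes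
    -- the terms of the form χ(d) times a symmetric polynomial.
    ∑-moment : ∑ L moment ≡ 0ℤ
    ∑-moment = ℤₚ.*-cancelˡ-≡ (+ 2) _ _ (begin
      + 2 * ∑ L moment
        ≡⟨ sym (∑-distribˡ-* L (+ 2) moment) ⟩
      ∑ L (λ z → + 2 * moment z)
        ≡⟨ ∑-cong L (λ {(x , d , e)} _ → lem (χ d) x d e) ⟩
      ∑ L (λ z → (weight z + negated z) + (symmetric z + symmetric z))
        ≡⟨ ∑-distrib-+ L (λ z → weight z + negated z) (λ z → symmetric z + symmetric z) ⟩
      ∑ L (λ z → weight z + negated z) + ∑ L (λ z → symmetric z + symmetric z)
        ≡⟨ cong₂ _+_ (trans (∑-distrib-+ L weight negated) (cong₂ _+_ ∑-weight (trans (∑-negate-x N weight) ∑-weight)))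
                     (trans (∑-distrib-+ L symmetric symmetric) (cong₂ _+_ ∑-symmetric ∑-symmetric)) ⟩
      0ℤ ∎)
      where
      negated symmetric : Triple → ℤ
      negated (x , d , e) = weight (- x - 1ℤ , d , e)
      symmetric (x , d , e) = χ d * (((+ 2 * x + 1ℤ) * (+ 2 * x + 1ℤ)) * ((+ 2 * x + 1ℤ) * (+ 2 * x + 1ℤ) - + 3 * (d * e)))
      ∑-weight : ∑ L weight ≡ 0ℤ
      ∑-weight = i≡-i⇒i≡0 (trans (sym (∑-φ N weight))
        (trans (∑-cong L (λ {(x , d , e)} p → weight-φ x d e (∈-solutions⁻ N p))) (∑-neg L weight)))
      ∑-symmetric : ∑ L symmetric ≡ 0ℤ
      ∑-symmetric = i≡-i⇒i≡0 (trans (sym (∑-swap N symmetric))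
        (trans (∑-cong L (λ {(x , d , e)} p → trans
                 (cong₂ (λ c p → c * (((+ 2 * x + 1ℤ) * (+ 2 * x + 1ℤ)) * ((+ 2 * x + 1ℤ) * (+ 2 * x + 1ℤ) - + 3 * p)))
                        (proj₁ (χ-opposite x d e (∈-solutions⁻ N p))) (ℤₚ.*-comm e d))
                 (sym (ℤₚ.neg-distribˡ-* (χ d) _))))
               (∑-neg L symmetric)))
      lem : ∀ c x d e → + 2 * ((d * e - + 3 * ((+ 2 * x + 1ℤ) * (+ 2 * x + 1ℤ))) * (c * (d * d))) ≡
        (c * ((+ 2 * x + 1ℤ + d) * (+ 2 * x + 1ℤ + d) * (+ 2 * x + 1ℤ + d) * (e - (+ 2 * x + 1ℤ)))
         + c * ((+ 2 * (- x - 1ℤ) + 1ℤ + d) * (+ 2 * (- x - 1ℤ) + 1ℤ + d) * (+ 2 * (- x - 1ℤ) + 1ℤ + d) * (e - (+ 2 * (- x - 1ℤ) + 1ℤ))))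
        + (c * (((+ 2 * x + 1ℤ) * (+ 2 * x + 1ℤ)) * ((+ 2 * x + 1ℤ) * (+ 2 * x + 1ℤ) - + 3 * (d * e)))
           + c * (((+ 2 * x + 1ℤ) * (+ 2 * x + 1ℤ)) * ((+ 2 * x + 1ℤ) * (+ 2 * x + 1ℤ) - + 3 * (d * e))))
      lem = solve-∀

  cubicSeries : Series
  cubicSeries = divisorSeries 3 (λ d e → χ d * (d * d))

  -- Writing n - 7T as 7(n - T) - 6n avoids expanding Dψ: the two terms are coefficients of ψ DC and
  -- of D(ψC), and the Leibniz rule does the rest.
  cubicSeries-recurrence : ∀ n → (ψ ⊛ D cubicSeries) n ≡ + 6 * (D ψ ⊛ cubicSeries) n
  cubicSeries-recurrence n = begin
    a                             ≡⟨ lem₁ a b ⟩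
    (+ 7 * a - + 6 * (b + a)) + + 6 * b ≡⟨ cong (_+ + 6 * b) vanishing ⟩
    0ℤ + + 6 * b                  ≡⟨ ℤₚ.+-identityˡ (+ 6 * b) ⟩
    + 6 * b                       ∎
    where
    C = cubicSeries
    N = 4 ℕ.* n ℕ.+ 3
    K = suc N
    a = (ψ ⊛ D C) n
    b = (D ψ ⊛ C) n
    n<K : n < K
    n<K = s≤s (ℕₚ.≤-trans (ℕₚ.m≤n*m n 4) (ℕₚ.m≤m+n (4 ℕ.* n) 3))
    S : ℕ → ℤ
    S k = shift (tri k) C n
    -- This is de - 3X² as a function of x alone, from de = N - `quad x`, X² = 2 `quad x` + 1 and N
    -- - 3 = 4n.
    U : ℤ → ℤ
    U x = + 4 * + n - + 7 * quad x
    lem₁ : ∀ a b → a ≡ (+ 7 * a - + 6 * (b + a)) + + 6 * b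
    lem₁ = solve-∀
    lem₂ : ∀ n T S → + 8 * (+ 7 * ((n - T) * S) + (- + 6 * n) * S) ≡ ((+ 4 * n - + 7 * (+ 4 * T)) + (+ 4 * n - + 7 * (+ 4 * T))) * S
    lem₂ = solve-∀
    lem₄ : ∀ v x p → (p - + 3 * ((+ 2 * x + 1ℤ) * (+ 2 * x + 1ℤ))) * v
                     ≡ ((+ 2 * (x * (x + 1ℤ)) + p - + 3) - + 7 * (+ 2 * (x * (x + 1ℤ)))) * v
    lem₄ = solve-∀
    N-3 : + N - + 3 ≡ + 4 * + n
    N-3 = trans (cong (_- + 3) (trans (ℤₚ.pos-+ (4 ℕ.* n) 3) (cong (_+ + 3) (ℤₚ.pos-* 4 n)))) (lem (+ n))
      where
      lem : ∀ n → + 4 * n + + 3 - + 3 ≡ + 4 * n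
      lem = solve-∀
    moment-split : ∀ {z} → z ∈ solutions N → moment n z ≡ U (proj₁ z) * (χ (proj₁ (proj₂ z)) * (proj₁ (proj₂ z) * proj₁ (proj₂ z)))
    moment-split {x , d , e} p with _ , _ , eq ← ∈-solutions⁻ N p =
      trans (lem₄ (χ d * (d * d)) x (d * e))
            (cong (λ z → (z - + 7 * quad x) * (χ d * (d * d))) (trans (cong (_- + 3) eq) N-3))
    -- Equivalent to Σₖ (n − 7 tri k) C(n − tri k) = 0, which is ∑-moment.
    vanishing : + 7 * a - + 6 * (b + a) ≡ 0ℤ
    -- 8 is 4 from `quad x` = 4T, times 2 for the two values of x with the same T.
    vanishing = ℤₚ.*-cancelˡ-≡ (+ 8) _ _ (begin
      + 8 * (+ 7 * a - + 6 * (b + a))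
        ≡⟨ cong (λ z → + 8 * (+ 7 * a - + 6 * z)) (sym (D-⊛ ψ C n)) ⟩
      + 8 * (+ 7 * a - + 6 * (+ n * (ψ ⊛ C) n))
        ≡⟨ cong₂ (λ x y → + 8 * (+ 7 * x - + 6 * (+ n * y))) (ψ⊛ n<K (D C)) (ψ⊛ n<K C) ⟩
      + 8 * (+ 7 * ∑ (upTo K) (λ k → shift (tri k) (D C) n) - + 6 * (+ n * ∑ (upTo K) S))
        ≡⟨ cong (+ 8 *_) (lem₅ (∑ (upTo K) (λ k → shift (tri k) (D C) n)) (+ n) (∑ (upTo K) S)) ⟩
      + 8 * (+ 7 * ∑ (upTo K) (λ k → shift (tri k) (D C) n) + (- + 6 * + n) * ∑ (upTo K) S)
        ≡⟨ cong (+ 8 *_) (cong₂ _+_ (sym (∑-distribˡ-* (upTo K) (+ 7) (λ k → shift (tri k) (D C) n))) (sym (∑-distribˡ-* (upTo K) (- + 6 * + n) S))) ⟩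
      + 8 * (∑ (upTo K) (λ k → + 7 * shift (tri k) (D C) n) + ∑ (upTo K) (λ k → (- + 6 * + n) * S k))
        ≡⟨ cong (+ 8 *_) (sym (∑-distrib-+ (upTo K) (λ k → + 7 * shift (tri k) (D C) n) (λ k → (- + 6 * + n) * S k))) ⟩
      + 8 * ∑ (upTo K) (λ k → + 7 * shift (tri k) (D C) n + (- + 6 * + n) * S k)
        ≡⟨ sym (∑-distribˡ-* (upTo K) (+ 8) (λ k → + 7 * shift (tri k) (D C) n + (- + 6 * + n) * S k)) ⟩
      ∑ (upTo K) (λ k → + 8 * (+ 7 * shift (tri k) (D C) n + (- + 6 * + n) * S k))
        ≡⟨ ∑-cong (upTo K) (λ {k} _ → term k) ⟩
      ∑ (upTo K) (λ k → (U (+ k) + U -[1+ k ]) * S k)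
        ≡⟨ sym (∑-solutions n 3 (s≤s (s≤s (s≤s (s≤s z≤n)))) (λ d e → χ d * (d * d)) U) ⟩
      ∑ (solutions N) (λ (x , d , e) → U x * (χ d * (d * d)))
        ≡⟨ sym (∑-cong (solutions N) moment-split) ⟩
      ∑ (solutions N) (moment n)
        ≡⟨ ∑-moment n ⟩
      0ℤ ∎)
      where
      lem₅ : ∀ a n b → + 7 * a - + 6 * (n * b) ≡ + 7 * a + (- + 6 * n) * b
      lem₅ = solve-∀
      term : ∀ k → + 8 * (+ 7 * shift (tri k) (D C) n + (- + 6 * + n) * S k) ≡ (U (+ k) + U -[1+ k ]) * S k
      term k = begin
        + 8 * (+ 7 * shift (tri k) (D C) n + (- + 6 * + n) * S k)
          ≡⟨ cong (λ z → + 8 * (+ 7 * z + (- + 6 * + n) * S k)) (D-shift (tri k) C n) ⟩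
        + 8 * (+ 7 * ((+ n - + tri k) * S k) + (- + 6 * + n) * S k)
          ≡⟨ lem₂ (+ n) (+ tri k) (S k) ⟩
        ((+ 4 * + n - + 7 * (+ 4 * + tri k)) + (+ 4 * + n - + 7 * (+ 4 * + tri k))) * S k
          ≡⟨ cong₂ (λ y z → ((+ 4 * + n - + 7 * y) + (+ 4 * + n - + 7 * z)) * S k)
                   (sym (quad≡4tri (+ k))) (sym (quad≡4tri -[1+ k ])) ⟩
        (U (+ k) + U -[1+ k ]) * S k ∎

  -- The boundary of the involution when N = 4n

  tri-injective : ∀ {a b} → tri a ≡ tri b → a ≡ b
  tri-injective {a} {b} eq with ℕₚ.<-cmp a b
  ... | tri≈ _ a≡b _ = a≡b
  ... | tri< a<b _ _ = contradiction (trans (sym (2*tri a)) (trans (cong (ℕ._* 2) eq) (2*tri b)))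
                                     (ℕₚ.<⇒≢ (ℕₚ.*-mono-< a<b (s≤s a<b)))
  ... | tri> _ _ b<a = contradiction (trans (sym (2*tri b)) (trans (cong (ℕ._* 2) (sym eq)) (2*tri a)))
                                     (ℕₚ.<⇒≢ (ℕₚ.*-mono-< b<a (s≤s b<a)))

  ψ-tri : ∀ r → ψ (tri r) ≡ 1ℤ
  ψ-tri r = begin
    ∑ (upTo (suc (tri r))) f
      ≡⟨ ∑-filter-support P? (upTo (suc (tri r))) (λ _ k≢r → δ-≢ (k≢r ∘ tri-injective)) ⟩
    ∑ (filter P? (upTo (suc (tri r)))) f
      ≡⟨ ∑-set-cong (Unique.filter⁺ P? (Unique.upTo⁺ _)) ([] ∷ [])
           (λ p → here (proj₂ (∈-filter⁻ P? {xs = upTo (suc (tri r))} p)))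
           (λ { (here refl) → ∈-filter⁺ P? (∈-upTo⁺ (s≤s (n≤tri r))) refl }) f ⟩
    f r + 0ℤ
      ≡⟨ trans (ℤₚ.+-identityʳ (f r)) (δ-≡ (tri r)) ⟩
    1ℤ ∎
    where
    P? = λ k → k ℕ.≟ r
    f = λ k → δ (tri k) (tri r)

  ψ-nontri : ∀ n → (∀ r → tri r ≢ n) → ψ n ≡ 0ℤ
  ψ-nontri n ne = ∑-zero (upTo (suc n)) (λ {k} _ → δ-≢ (ne k))

  half-positive : ∀ i {a} → + 2 * i ≡ +[1+ a ] → Positive i
  half-positive +[1+ j ] _ = j , refl

  half-natural : ∀ i {m} → + 2 * i ≡ + m → ∃ λ r → i ≡ + r
  half-natural (+ r) _ = r , refl

  quad≡4*⇒tri : ∀ k {n} → quad (+ k) ≡ + 4 * + n → tri k ≡ n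
  quad≡4*⇒tri k {n} eq = ℤₚ.+-injective (ℤₚ.*-cancelˡ-≡ (+ 4) (+ tri k) (+ n) (trans (sym (quad≡4tri (+ k))) eq))

  -- The triples with e = 2s and with d = 2(e - X), for n = `tri r`. There the equation collapses to
  -- `quad y` = 4n with y = x + d and y = e - x - 1 respectively, so y = r. The free parameter j is
  -- s - 1 in the first family and e - 1 in the second.
  pointₜ pointᵤ : ℕ → ℕ → Triple
  pointₜ r j = + j - + r , + 2 * + r - + j , + 2 * + suc j
  pointᵤ r j = + j - + r , + 2 * (+ 2 * + r - + j) , + suc j

  gap : ∀ r j → j < r ℕ.* 2 → ∃ λ a → + 2 * + r - + j ≡ +[1+ a ]
  gap r j j<2r with a , eq ← ℕₚ.m≤n⇒∃[o]m+o≡n j<2r = a , (begin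
    + 2 * + r - + j                ≡⟨ cong (_- + j) (trans (ℤₚ.*-comm (+ 2) (+ r)) (sym (ℤₚ.pos-* r 2))) ⟩
    + (r ℕ.* 2) - + j              ≡⟨ cong (λ z → + z - + j) (sym eq) ⟩
    (1ℤ + (+ j + + a)) - + j       ≡⟨ lem (+ j) (+ a) ⟩
    1ℤ + + a                       ∎)
    where
    lem : ∀ j a → (1ℤ + (j + a)) - j ≡ 1ℤ + a
    lem = solve-∀

  gap⁻ : ∀ r j {a} → + 2 * + r - + j ≡ +[1+ a ] → j < r ℕ.* 2
  gap⁻ r j {a} eq = subst (j <_) (ℤₚ.+-injective (begin
    1ℤ + (+ j + + a)       ≡⟨ lem₁ (+ j) (+ a) ⟩
    (1ℤ + + a) + + j       ≡⟨ cong (_+ + j) (sym eq) ⟩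
    + 2 * + r - + j + + j  ≡⟨ lem₂ (+ r) (+ j) ⟩
    + r * + 2              ≡⟨ sym (ℤₚ.pos-* r 2) ⟩
    + (r ℕ.* 2)            ∎)) (s≤s (ℕₚ.m≤m+n j a))
    where
    lem₁ : ∀ j a → 1ℤ + (j + a) ≡ (1ℤ + a) + j
    lem₁ = solve-∀
    lem₂ : ∀ r j → + 2 * r - j + j ≡ r * + 2
    lem₂ = solve-∀

  module _ (n : ℕ) where
    private
      N = 4 ℕ.* n ℕ.+ 0
      L = solutions N
      N≡ : + N ≡ + 4 * + n
      N≡ = trans (cong +_ (ℕₚ.+-identityʳ (4 ℕ.* n))) (ℤₚ.pos-* 4 n)

    evenWeight doubled : Triple → ℤ
    evenWeight (x , d , e) = κ d * η e * (+ 2 * x + 1ℤ + d)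
    doubled z = evenWeight z + evenWeight (φ z)

    -- For e = 2g one has u = 4(g - x) - (2 + d); κ is even and changes sign under a shift by 2. For
    -- odd e both sides vanish.
    κη-u : ∀ x d e → κ (u x d e) * η e ≡ - (κ d * η e)
    κη-u x d e with parity e
    ... | inj₁ (g , refl) = trans (cong (λ i → κ i * η (+ 2 * g)) (lem x d g))
                                  (trans (cong (_* η (+ 2 * g)) (κ-reflect (g - x) d)) (sym (ℤₚ.neg-distribˡ-* (κ d) (η (+ 2 * g)))))
      where
      lem : ∀ x d g → + 2 * (+ 2 * g) - + 2 * (+ 2 * x + 1ℤ) - d ≡ + 4 * (g - x) + - (+ 2 + d)
      lem = solve-∀
    ... | inj₂ (η≡0 , _)  = trans (cong (κ (u x d e) *_) η≡0) (trans (ℤₚ.*-zeroʳ (κ (u x d e)))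
                              (sym (cong -_ (trans (cong (κ d *_) η≡0) (ℤₚ.*-zeroʳ (κ d))))))

    η-t : ∀ x d e → η (t x d e) ≡ η e
    η-t x d e = trans (cong η (lem x d e)) (η-2periodic (- (+ 2 * x + 1ℤ + d)) e)
      where
      lem : ∀ x d e → e - + 2 * (+ 2 * x + 1ℤ + d) ≡ + 2 * - (+ 2 * x + 1ℤ + d) + e
      lem = solve-∀

    -- Reflection negates s, and t has the parity of e. The other two moves keep s and negate the
    -- product of κ and η.
    doubled-zero : ∀ x d e → t x d e * u x d e ≢ 0ℤ → doubled (x , d , e) ≡ 0ℤ
    doubled-zero x d e tu≢0 = go (region x d e)
      where
      w = evenWeight (x , d , e)
      S = + 2 * x + 1ℤ + d
      cancel : evenWeight (φ (x , d , e)) ≡ - w → doubled (x , d , e) ≡ 0ℤ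
      cancel eq = trans (cong (_+_ w) eq) (ℤₚ.+-inverseʳ w)
      go : Region x d e → doubled (x , d , e) ≡ 0ℤ
      go (reflected p) = cancel (trans (cong evenWeight (φ-reflected x d e p))
        (trans (cong (λ z → κ d * z * (+ 2 * (- x - 1ℤ - d) + 1ℤ + d)) (η-t x d e)) (lem (κ d * η e) x d)))
        where
        lem : ∀ c x d → c * (+ 2 * (- x - 1ℤ - d) + 1ℤ + d) ≡ - (c * (+ 2 * x + 1ℤ + d))
        lem = solve-∀
      go (exchanged p q) = cancel (trans (cong evenWeight (φ-exchanged x d e p q))
        (trans (cong₂ _*_ (trans (cong (κ (u x d e) *_) (trans (cyc-neg _ _ _ _ (t x d e)) (η-t x d e))) (κη-u x d e)) (lem x d e))
               (sym (ℤₚ.neg-distribˡ-* (κ d * η e) S))))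
        where
        lem : ∀ x d e → + 2 * (+ 3 * x + 1ℤ + d - e) + 1ℤ + (+ 2 * e - + 2 * (+ 2 * x + 1ℤ) - d) ≡ + 2 * x + 1ℤ + d
        lem = solve-∀
      go (flipped p q) = cancel (trans (cong evenWeight (φ-flipped x d e p q))
        (trans (cong₂ _*_ (trans (cong (_* η e) (κ-neg (u x d e))) (κη-u x d e)) (lem x d e))
               (sym (ℤₚ.neg-distribˡ-* (κ d * η e) S))))
        where
        lem : ∀ x d e → + 2 * (e - x - 1ℤ) + 1ℤ + - (+ 2 * e - + 2 * (+ 2 * x + 1ℤ) - d) ≡ + 2 * x + 1ℤ + d
        lem = solve-∀
      go (boundaryₜ p)   = contradiction (trans (cong (_* u x d e) p) (ℤₚ.*-zeroˡ (u x d e))) tu≢0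
      go (boundaryᵤ _ q) = contradiction (trans (cong (t x d e *_) q) (ℤₚ.*-zeroʳ (t x d e))) tu≢0

    ∑-evenWeight-doubled : + 2 * ∑ L evenWeight ≡ ∑ L doubled
    ∑-evenWeight-doubled = begin
      + 2 * ∑ L evenWeight                        ≡⟨ lem (∑ L evenWeight) ⟩
      ∑ L evenWeight + ∑ L evenWeight             ≡⟨ cong (_+_ (∑ L evenWeight)) (sym (∑-φ N evenWeight)) ⟩
      ∑ L evenWeight + ∑ L (evenWeight ∘ φ)       ≡⟨ sym (∑-distrib-+ L evenWeight (evenWeight ∘ φ)) ⟩
      ∑ L doubled                                 ∎
      where
      lem : ∀ a → + 2 * a ≡ a + a
      lem = solve-∀

    boundary? : (z : Triple) → Dec (t (proj₁ z) (proj₁ (proj₂ z)) (proj₂ (proj₂ z)) * u (proj₁ z) (proj₁ (proj₂ z)) (proj₂ (proj₂ z)) ≡ 0ℤ)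
    boundary? (x , d , e) = t x d e * u x d e ℤₚ.≟ 0ℤ

    boundary : List Triple
    boundary = filter boundary? L

    ∑-doubled-boundary : ∑ L doubled ≡ ∑ boundary doubled
    ∑-doubled-boundary = ∑-filter-support boundary? L (λ {(x , d , e)} _ → doubled-zero x d e)

    BoundaryPoint : (ℕ → ℕ → Triple) → Triple → Set
    BoundaryPoint point z = ∃ λ r → tri r ≡ n × ∃ λ j → j < r ℕ.* 2 × z ≡ point r j

    boundaryₜ-coordinates : ∀ x d e {a j r} → quad x + d * e ≡ + N → d ≡ +[1+ a ] → e ≡ + 2 * (+ 2 * x + 1ℤ + d) →
      + 2 * x + 1ℤ + d ≡ +[1+ j ] → x + d ≡ + r → BoundaryPoint pointₜ (x , d , e)
    boundaryₜ-coordinates x d e {a} {j} {r} eq d≡ e≡2s s≡ y≡ =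
      r , quad≡4*⇒tri r quad-r , j , gap⁻ r j (trans (sym d-form) d≡) , triple-≡ x-form d-form (trans e≡2s (cong (+ 2 *_) s≡))
      where
      quad-r : quad (+ r) ≡ + 4 * + n
      quad-r = begin
        quad (+ r)                                     ≡⟨ cong quad (sym y≡) ⟩
        quad (x + d)                                   ≡⟨ lem x d ⟩
        quad x + d * (+ 2 * (+ 2 * x + 1ℤ + d))        ≡⟨ cong (λ z → quad x + d * z) (sym e≡2s) ⟩
        quad x + d * e                                 ≡⟨ trans eq N≡ ⟩
        + 4 * + n                                      ∎
        where
        lem : ∀ x d → + 2 * ((x + d) * ((x + d) + 1ℤ)) ≡ + 2 * (x * (x + 1ℤ)) + d * (+ 2 * (+ 2 * x + 1ℤ + d))
        lem = solve-∀
      x-form : x ≡ + j - + r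
      x-form = trans (lem₁ x d) (trans (cong₂ (λ y z → y - 1ℤ - z) s≡ y≡) (lem₂ (+ j) (+ r)))
        where
        lem₁ : ∀ x d → x ≡ (+ 2 * x + 1ℤ + d) - 1ℤ - (x + d)
        lem₁ = solve-∀
        lem₂ : ∀ j r → (1ℤ + j) - 1ℤ - r ≡ j - r
        lem₂ = solve-∀
      d-form : d ≡ + 2 * + r - + j
      d-form = trans (lem₁ x d) (trans (cong₂ (λ y z → + 2 * y - (z - 1ℤ)) y≡ s≡) (lem₂ (+ j) (+ r)))
        where
        lem₁ : ∀ x d → d ≡ + 2 * (x + d) - ((+ 2 * x + 1ℤ + d) - 1ℤ)
        lem₁ = solve-∀
        lem₂ : ∀ j r → + 2 * r - ((1ℤ + j) - 1ℤ) ≡ + 2 * r - j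
        lem₂ = solve-∀

    boundaryₜ-form : ∀ x d e → IsSolution N x d e → t x d e ≡ 0ℤ → BoundaryPoint pointₜ (x , d , e)
    boundaryₜ-form x d e ((a , d≡) , (b , e≡) , eq) t≡0
      = go (half-positive (+ 2 * x + 1ℤ + d) (trans (sym (e≡2s t≡0)) e≡))
      where
      e≡2s : e - + 2 * (+ 2 * x + 1ℤ + d) ≡ 0ℤ → e ≡ + 2 * (+ 2 * x + 1ℤ + d)
      e≡2s = ℤₚ.i-j≡0⇒i≡j e (+ 2 * (+ 2 * x + 1ℤ + d))
      -- Since 2(x + d) = (s - 1) + d with s and d positive, x + d is a natural number, which
      -- selects r rather than -1 - r.
      sum≡ : ∀ a j → d ≡ +[1+ a ] → + 2 * x + 1ℤ + d ≡ +[1+ j ] → + 2 * (x + d) ≡ + (j ℕ.+ suc a)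
      sum≡ a j d≡ s≡ = trans (lem₁ x d) (trans (cong₂ (λ y z → y - 1ℤ + z) s≡ d≡) (lem₂ (+ j) (+ a)))
        where
        lem₁ : ∀ x d → + 2 * (x + d) ≡ (+ 2 * x + 1ℤ + d) - 1ℤ + d
        lem₁ = solve-∀
        lem₂ : ∀ j a → (1ℤ + j) - 1ℤ + (1ℤ + a) ≡ j + (1ℤ + a)
        lem₂ = solve-∀
      go : Positive (+ 2 * x + 1ℤ + d) → BoundaryPoint pointₜ (x , d , e)
      go (j , s≡) with r , y≡ ← half-natural (x + d) (sum≡ a j d≡ s≡) = boundaryₜ-coordinates x d e eq d≡ (e≡2s t≡0) s≡ y≡

    boundaryᵤ-coordinates : ∀ x d e {f j r} → quad x + d * e ≡ + N → d ≡ + 2 * (e - (+ 2 * x + 1ℤ)) →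
      e - (+ 2 * x + 1ℤ) ≡ +[1+ f ] → e ≡ +[1+ j ] → e - x - 1ℤ ≡ + r → BoundaryPoint pointᵤ (x , d , e)
    boundaryᵤ-coordinates x d e {f} {j} {r} eq d≡2f f≡ e≡ y≡ =
      r , quad≡4*⇒tri r quad-r , j , gap⁻ r j (trans (sym f-form) f≡) , triple-≡ x-form (trans d≡2f (cong (+ 2 *_) f-form)) e≡
      where
      quad-r : quad (+ r) ≡ + 4 * + n
      quad-r = begin
        quad (+ r)                                     ≡⟨ cong quad (sym y≡) ⟩
        quad (e - x - 1ℤ)                              ≡⟨ lem x e ⟩
        quad x + + 2 * (e - (+ 2 * x + 1ℤ)) * e        ≡⟨ cong (λ z → quad x + z * e) (sym d≡2f) ⟩
        quad x + d * e                                 ≡⟨ trans eq N≡ ⟩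
        + 4 * + n                                      ∎
        where
        lem : ∀ x e → + 2 * ((e - x - 1ℤ) * ((e - x - 1ℤ) + 1ℤ)) ≡ + 2 * (x * (x + 1ℤ)) + + 2 * (e - (+ 2 * x + 1ℤ)) * e
        lem = solve-∀
      x-form : x ≡ + j - + r
      x-form = trans (lem₁ x e) (trans (cong₂ (λ y z → y - 1ℤ - z) e≡ y≡) (lem₂ (+ j) (+ r)))
        where
        lem₁ : ∀ x e → x ≡ e - 1ℤ - (e - x - 1ℤ)
        lem₁ = solve-∀
        lem₂ : ∀ j r → (1ℤ + j) - 1ℤ - r ≡ j - r
        lem₂ = solve-∀
      f-form : e - (+ 2 * x + 1ℤ) ≡ + 2 * + r - + j
      f-form = trans (lem₁ x e) (trans (cong₂ (λ y z → + 2 * y - (z - 1ℤ)) y≡ e≡) (lem₂ (+ j) (+ r)))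
        where
        lem₁ : ∀ x e → e - (+ 2 * x + 1ℤ) ≡ + 2 * (e - x - 1ℤ) - (e - 1ℤ)
        lem₁ = solve-∀
        lem₂ : ∀ j r → + 2 * r - ((1ℤ + j) - 1ℤ) ≡ + 2 * r - j
        lem₂ = solve-∀

    boundaryᵤ-form : ∀ x d e → IsSolution N x d e → u x d e ≡ 0ℤ → BoundaryPoint pointᵤ (x , d , e)
    boundaryᵤ-form x d e ((a , d≡) , (j , e≡) , eq) u≡0
      = go (half-positive (e - (+ 2 * x + 1ℤ)) (trans (sym (d≡2f u≡0)) d≡))
      where
      d≡2f : + 2 * e - + 2 * (+ 2 * x + 1ℤ) - d ≡ 0ℤ → d ≡ + 2 * (e - (+ 2 * x + 1ℤ))
      d≡2f u≡0 = trans (sym (ℤₚ.i-j≡0⇒i≡j (+ 2 * e - + 2 * (+ 2 * x + 1ℤ)) d u≡0)) (lem x e)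
        where
        lem : ∀ x e → + 2 * e - + 2 * (+ 2 * x + 1ℤ) ≡ + 2 * (e - (+ 2 * x + 1ℤ))
        lem = solve-∀
      sum≡ : ∀ f j → e - (+ 2 * x + 1ℤ) ≡ +[1+ f ] → e ≡ +[1+ j ] → + 2 * (e - x - 1ℤ) ≡ + (f ℕ.+ suc j)
      sum≡ f j f≡ e≡ = trans (lem₁ x e) (trans (cong₂ (λ y z → y - 1ℤ + z) f≡ e≡) (lem₂ (+ f) (+ j)))
        where
        lem₁ : ∀ x e → + 2 * (e - x - 1ℤ) ≡ (e - (+ 2 * x + 1ℤ)) - 1ℤ + e
        lem₁ = solve-∀
        lem₂ : ∀ j a → (1ℤ + j) - 1ℤ + (1ℤ + a) ≡ j + (1ℤ + a)
        lem₂ = solve-∀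
      go : Positive (e - (+ 2 * x + 1ℤ)) → BoundaryPoint pointᵤ (x , d , e)
      go (f , f≡) with r , y≡ ← half-natural (e - x - 1ℤ) (sum≡ f j f≡ e≡) = boundaryᵤ-coordinates x d e eq (d≡2f u≡0) f≡ e≡ y≡

    boundary-form : ∀ z → z ∈ boundary → BoundaryPoint pointₜ z ⊎ BoundaryPoint pointᵤ z
    boundary-form (x , d , e) p = go (∈-solutions⁻ N (proj₁ q)) (ℤₚ.i*j≡0⇒i≡0∨j≡0 (t x d e) {u x d e} (proj₂ q))
      where
      q : (x , d , e) ∈ L × t x d e * u x d e ≡ 0ℤ
      q = ∈-filter⁻ boundary? {xs = L} p
      go : IsSolution N x d e → t x d e ≡ 0ℤ ⊎ u x d e ≡ 0ℤ → BoundaryPoint pointₜ (x , d , e) ⊎ BoundaryPoint pointᵤ (x , d , e)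
      go sol (inj₁ t≡0) = inj₁ (boundaryₜ-form x d e sol t≡0)
      go sol (inj₂ u≡0) = inj₂ (boundaryᵤ-form x d e sol u≡0)

  -- Sums over the two boundary families

  ∑-upTo-suc : ∀ n f → ∑ (upTo (suc n)) f ≡ ∑ (upTo n) f + f n
  ∑-upTo-suc n f = trans (cong (λ l → ∑ l f) (sym (upTo-∷ʳ n)))
    (trans (∑-++ (upTo n) (n ∷ []) f) (cong (_+_ (∑ (upTo n) f)) (ℤₚ.+-identityʳ (f n))))

  -- Passing from r to r + 1 moves the argument of κ by 2 and negates the old sum. Of the two new
  -- terms the first is -(2r + 1) and the second is zero.
  ∑-κ-linear : ∀ r → ∑ (upTo (r ℕ.* 2)) (λ j → κ (+ 2 * + r - + j) * + suc j) ≡ - + r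
  ∑-κ-linear zero    = refl
  ∑-κ-linear (suc r) = begin
    ∑ (upTo (suc (suc m))) f
      ≡⟨ trans (∑-upTo-suc (suc m) f) (cong (_+ f (suc m)) (∑-upTo-suc m f)) ⟩
    ∑ (upTo m) f + f m + f (suc m)
      ≡⟨ cong₂ _+_ (cong₂ _+_ bulk (cong (λ z → κ z * + suc m) last₀)) (cong (λ z → κ z * + suc (suc m)) last₁) ⟩
    - - + r + -1ℤ * + suc m + 0ℤ * + suc (suc m)
      ≡⟨ cong (λ z → - - + r + -1ℤ * (1ℤ + z) + 0ℤ * (1ℤ + (1ℤ + z))) (ℤₚ.pos-* r 2) ⟩
    - - + r + -1ℤ * (1ℤ + + r * + 2) + 0ℤ * (1ℤ + (1ℤ + + r * + 2))
      ≡⟨ lem (+ r) ⟩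
    - + suc r ∎
    where
    m = r ℕ.* 2
    f g : ℕ → ℤ
    f j = κ (+ 2 * + suc r - + j) * + suc j
    g j = κ (+ 2 * + r - + j) * + suc j
    lem : ∀ r → - - r + -1ℤ * (1ℤ + r * + 2) + 0ℤ * (1ℤ + (1ℤ + r * + 2)) ≡ - (1ℤ + r)
    lem = solve-∀
    last₀ : + 2 * + suc r - + m ≡ + 2
    last₀ = trans (cong (λ z → + 2 * + suc r - z) (ℤₚ.pos-* r 2)) (lem′ (+ r))
      where
      lem′ : ∀ r → + 2 * (1ℤ + r) - r * + 2 ≡ + 2
      lem′ = solve-∀
    last₁ : + 2 * + suc r - + suc m ≡ + 1
    last₁ = trans (cong (λ z → + 2 * + suc r - (1ℤ + z)) (ℤₚ.pos-* r 2)) (lem′ (+ r))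
      where
      lem′ : ∀ r → + 2 * (1ℤ + r) - (1ℤ + r * + 2) ≡ 1ℤ
      lem′ = solve-∀
    bulk : ∑ (upTo m) f ≡ - - + r
    bulk = trans (∑-cong (upTo m) (λ {j} _ → trans (cong (λ z → κ z * + suc j) (lem′ (+ r) (+ j)))
                    (trans (cong (_* + suc j) (κ-2shift (+ 2 * + r - + j))) (sym (ℤₚ.neg-distribˡ-* (κ (+ 2 * + r - + j)) (+ suc j))))))
                 (trans (∑-neg (upTo m) g) (cong -_ (∑-κ-linear r)))
      where
      lem′ : ∀ r j → + 2 * (1ℤ + r) - j ≡ + 2 + (+ 2 * r - j)
      lem′ = solve-∀

  -- Only odd j survive η; for these κ is taken at twice an odd number and equals -1. There are r of
  -- them below 2r.
  ∑-κη : ∀ r → ∑ (upTo (r ℕ.* 2)) (λ j → κ (+ 2 * (+ 2 * + r - + j)) * η (+ suc j)) ≡ - + r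
  ∑-κη zero    = refl
  ∑-κη (suc r) = begin
    ∑ (upTo (suc (suc m))) f
      ≡⟨ trans (∑-upTo-suc (suc m) f) (cong (_+ f (suc m)) (∑-upTo-suc m f)) ⟩
    ∑ (upTo m) f + f m + f (suc m)
      ≡⟨ cong₂ _+_ (cong₂ _+_ bulk (trans (cong (κ (+ 2 * (+ 2 * + suc r - + m)) *_) odd) (ℤₚ.*-zeroʳ (κ (+ 2 * (+ 2 * + suc r - + m))))))
                   (cong₂ _*_ (cong κ last) even) ⟩
    - + r + 0ℤ + -1ℤ
      ≡⟨ lem (+ r) ⟩
    - + suc r ∎
    where
    m = r ℕ.* 2
    f : ℕ → ℤ
    f j = κ (+ 2 * (+ 2 * + suc r - + j)) * η (+ suc j)
    lem : ∀ r → - r + 0ℤ + -1ℤ ≡ - (1ℤ + r)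
    lem = solve-∀
    odd : η (+ suc m) ≡ 0ℤ
    odd = trans (cong η (trans (cong (_+_ 1ℤ) (ℤₚ.pos-* r 2)) (lem′ (+ r)))) (η-2periodic (+ r) 1ℤ)
      where
      lem′ : ∀ r → 1ℤ + r * + 2 ≡ + 2 * r + 1ℤ
      lem′ = solve-∀
    even : η (+ suc (suc m)) ≡ 1ℤ
    even = trans (cong η (trans (cong (λ z → 1ℤ + (1ℤ + z)) (ℤₚ.pos-* r 2)) (lem′ (+ r)))) (η-2periodic (+ r) (+ 2))
      where
      lem′ : ∀ r → 1ℤ + (1ℤ + r * + 2) ≡ + 2 * r + + 2
      lem′ = solve-∀
    last : + 2 * (+ 2 * + suc r - + suc m) ≡ + 2
    last = trans (cong (λ z → + 2 * (+ 2 * + suc r - (1ℤ + z))) (ℤₚ.pos-* r 2)) (lem′ (+ r))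
      where
      lem′ : ∀ r → + 2 * (+ 2 * (1ℤ + r) - (1ℤ + r * + 2)) ≡ + 2
      lem′ = solve-∀
    bulk : ∑ (upTo m) f ≡ - + r
    bulk = trans (∑-cong (upTo m) (λ {j} _ → cong (_* η (+ suc j))
                    (trans (cong κ (lem′ (+ r) (+ j))) (cyc-4periodic _ _ _ _ 1ℤ (+ 2 * (+ 2 * + r - + j))))))
                 (∑-κη r)
      where
      lem′ : ∀ r j → + 2 * (+ 2 * (1ℤ + r) - j) ≡ + 4 * 1ℤ + + 2 * (+ 2 * r - j)
      lem′ = solve-∀

  module _ (r : ℕ) where
    private
      n = tri r
      N = 4 ℕ.* n ℕ.+ 0
      m = r ℕ.* 2

    boundaryPoints : List Triple
    boundaryPoints = map (pointₜ r) (upTo m) ++ map (pointᵤ r) (upTo m)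

    boundaryPoints-unique : Unique boundaryPoints
    boundaryPoints-unique = Unique.++⁺ (Unique.map⁺ injₜ (Unique.upTo⁺ m)) (Unique.map⁺ injᵤ (Unique.upTo⁺ m)) disjoint
      where
      same-x : ∀ i j → + i - + r ≡ + j - + r → i ≡ j
      same-x i j eq = ℤₚ.+-injective (trans (lem (+ i) (+ r)) (trans (cong (_+ + r) eq) (sym (lem (+ j) (+ r)))))
        where
        lem : ∀ a b → a ≡ a - b + b
        lem = solve-∀
      injₜ : ∀ {i j} → pointₜ r i ≡ pointₜ r j → i ≡ j
      injₜ {i} {j} eq = same-x i j (cong proj₁ eq)
      injᵤ : ∀ {i j} → pointᵤ r i ≡ pointᵤ r j → i ≡ j
      injᵤ {i} {j} eq = same-x i j (cong proj₁ eq)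
      -- Equal x forces equal j, but then e would be both 2(j + 1) and j + 1.
      clash : ∀ i j → pointₜ r i ≢ pointᵤ r j
      clash i j eq with refl ← same-x i j (cong proj₁ eq) =
        ℕₚ.m+1+n≢m (suc i) (ℤₚ.+-injective (cong (λ z → proj₂ (proj₂ z)) eq))
      disjoint : ∀ {z} → ¬ (z ∈ map (pointₜ r) (upTo m) × z ∈ map (pointᵤ r) (upTo m))
      disjoint (p , q) with i , _ , z≡ ← ∈-map⁻ (pointₜ r) p with j , _ , z≡′ ← ∈-map⁻ (pointᵤ r) q = clash i j (trans (sym z≡) z≡′)

    private
      on-quadric : + 2 * (+ r * (+ r + 1ℤ)) ≡ + N
      on-quadric = trans (quad≡4tri (+ r)) (sym (trans (cong +_ (ℕₚ.+-identityʳ (4 ℕ.* n))) (ℤₚ.pos-* 4 n)))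

      t-pointₜ : ∀ r j → + 2 * (1ℤ + j) - + 2 * (+ 2 * (j - r) + 1ℤ + (+ 2 * r - j)) ≡ 0ℤ
      t-pointₜ = solve-∀
      u-pointᵤ : ∀ r j → + 2 * (1ℤ + j) - + 2 * (+ 2 * (j - r) + 1ℤ) - + 2 * (+ 2 * r - j) ≡ 0ℤ
      u-pointᵤ = solve-∀

    pointₜ-solution : ∀ j → j < m → IsSol N (pointₜ r j)
    pointₜ-solution j j<m = gap r j j<m , (_ , refl) , trans (lem (+ r) (+ j)) on-quadric
      where
      lem : ∀ r j → + 2 * ((j - r) * ((j - r) + 1ℤ)) + (+ 2 * r - j) * (+ 2 * (1ℤ + j)) ≡ + 2 * (r * (r + 1ℤ))
      lem = solve-∀

    pointᵤ-solution : ∀ j → j < m → IsSol N (pointᵤ r j)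
    pointᵤ-solution j j<m = (_ , cong (+ 2 *_) (proj₂ (gap r j j<m))) , (_ , refl) , trans (lem (+ r) (+ j)) on-quadric
      where
      lem : ∀ r j → + 2 * ((j - r) * ((j - r) + 1ℤ)) + + 2 * (+ 2 * r - j) * (1ℤ + j) ≡ + 2 * (r * (r + 1ℤ))
      lem = solve-∀

    boundary⇒points : ∀ {z} → z ∈ boundary n → z ∈ boundaryPoints
    boundary⇒points {z} p = go (boundary-form n z p)
      where
      go : BoundaryPoint n pointₜ z ⊎ BoundaryPoint n pointᵤ z → z ∈ boundaryPoints
      go (inj₁ (r′ , r′≡ , j , j< , refl)) with refl ← tri-injective {r′} {r} r′≡ =
        ∈-++⁺ˡ (∈-map⁺ (pointₜ r) (∈-upTo⁺ j<))
      go (inj₂ (r′ , r′≡ , j , j< , refl)) with refl ← tri-injective {r′} {r} r′≡ =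
        ∈-++⁺ʳ (map (pointₜ r) (upTo m)) (∈-map⁺ (pointᵤ r) (∈-upTo⁺ j<))

    points⇒boundary : ∀ {z} → z ∈ boundaryPoints → z ∈ boundary n
    points⇒boundary p with ∈-++⁻ (map (pointₜ r) (upTo m)) p
    ... | inj₁ q with j , j∈ , refl ← ∈-map⁻ (pointₜ r) q =
      ∈-filter⁺ (boundary? n) (∈-solutions⁺ (pointₜ-solution j (∈-upTo⁻ j∈)))
        (trans (cong (_* u (+ j - + r) (+ 2 * + r - + j) (+ 2 * + suc j)) (t-pointₜ (+ r) (+ j)))
               (ℤₚ.*-zeroˡ (u (+ j - + r) (+ 2 * + r - + j) (+ 2 * + suc j))))
    ... | inj₂ q with j , j∈ , refl ← ∈-map⁻ (pointᵤ r) q =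
      ∈-filter⁺ (boundary? n) (∈-solutions⁺ (pointᵤ-solution j (∈-upTo⁻ j∈)))
        (trans (cong (t (+ j - + r) (+ 2 * (+ 2 * + r - + j)) (+ suc j) *_) (u-pointᵤ (+ r) (+ j)))
               (ℤₚ.*-zeroʳ (t (+ j - + r) (+ 2 * (+ 2 * + r - + j)) (+ suc j))))

    -- In this family s = j + 1.
    doubled-pointₜ : ∀ j → doubled n (pointₜ r j) ≡ + 2 * (κ (+ 2 * + r - + j) * + suc j)
    doubled-pointₜ j = begin
      w + evenWeight n (φ z)
        ≡⟨ cong (λ z → w + evenWeight n z) (φ-boundaryₜ (+ j - + r) (+ 2 * + r - + j) (+ 2 * + suc j) (t-pointₜ (+ r) (+ j))) ⟩
      w + w
        ≡⟨ lem w ⟩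
      + 2 * w
        ≡⟨ cong (+ 2 *_) (cong₂ _*_ (trans (cong (c *_) (η-double (+ suc j))) (ℤₚ.*-identityʳ c))
                                    (lem′ (+ r) (+ j))) ⟩
      + 2 * (c * + suc j) ∎
      where
      z = pointₜ r j
      w = evenWeight n z
      c = κ (+ 2 * + r - + j)
      lem : ∀ a → a + a ≡ + 2 * a
      lem = solve-∀
      lem′ : ∀ r j → + 2 * (j - r) + 1ℤ + (+ 2 * r - j) ≡ 1ℤ + j
      lem′ = solve-∀

    -- In this family s = 2r + 1 for every j.
    doubled-pointᵤ : ∀ j → j < m → doubled n (pointᵤ r j) ≡ (+ 2 * (+ 2 * + r + 1ℤ)) * (κ (+ 2 * (+ 2 * + r - + j)) * η (+ suc j))
    doubled-pointᵤ j j<m = begin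
      w + evenWeight n (φ z)
        ≡⟨ cong (λ z → w + evenWeight n z) (φ-boundaryᵤ (+ j - + r) (+ 2 * (+ 2 * + r - + j)) (+ suc j) t-neg (u-pointᵤ (+ r) (+ j))) ⟩
      w + w
        ≡⟨ lem (κ (+ 2 * (+ 2 * + r - + j)) * η (+ suc j)) (+ r) (+ j) ⟩
      (+ 2 * (+ 2 * + r + 1ℤ)) * (κ (+ 2 * (+ 2 * + r - + j)) * η (+ suc j)) ∎
      where
      z = pointᵤ r j
      w = evenWeight n z
      -- Negativity of t matters: with u = 0 and t > 0 the point would be reflected instead of
      -- fixed.
      t-neg : t (+ j - + r) (+ 2 * (+ 2 * + r - + j)) (+ suc j) ≡ - (+[1+ proj₁ (gap r j j<m) ] + (1ℤ + (+ r + + r)))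
      t-neg = trans (lem₁ (+ r) (+ j)) (cong (λ z → - (z + (1ℤ + (+ r + + r)))) (proj₂ (gap r j j<m)))
        where
        lem₁ : ∀ r j → (1ℤ + j) - + 2 * (+ 2 * (j - r) + 1ℤ + + 2 * (+ 2 * r - j)) ≡ - ((+ 2 * r - j) + (1ℤ + (r + r)))
        lem₁ = solve-∀
      lem : ∀ c r j → c * (+ 2 * (j - r) + 1ℤ + + 2 * (+ 2 * r - j)) + c * (+ 2 * (j - r) + 1ℤ + + 2 * (+ 2 * r - j)) ≡ + 2 * (+ 2 * r + 1ℤ) * c
      lem = solve-∀

    -- The families contribute -2r and -2r(2r + 1), together -4r(r + 1), which is -8 `tri r`.
    ∑-boundary : ∑ (boundary n) (doubled n) ≡ - + 8 * + n
    ∑-boundary = begin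
      ∑ (boundary n) (doubled n)
        ≡⟨ ∑-set-cong (Unique.filter⁺ (boundary? n) (solutions-unique N)) boundaryPoints-unique boundary⇒points points⇒boundary (doubled n) ⟩
      ∑ boundaryPoints (doubled n)
        ≡⟨ ∑-++ (map (pointₜ r) (upTo m)) (map (pointᵤ r) (upTo m)) (doubled n) ⟩
      ∑ (map (pointₜ r) (upTo m)) (doubled n) + ∑ (map (pointᵤ r) (upTo m)) (doubled n)
        ≡⟨ cong₂ _+_ sumₜ sumᵤ ⟩
      + 2 * - + r + (+ 2 * (+ 2 * + r + 1ℤ)) * - + r
        ≡⟨ lem (+ r) ⟩
      - + 2 * (+ 2 * (+ r * (+ r + 1ℤ)))
        ≡⟨ cong (- + 2 *_) (quad≡4tri (+ r)) ⟩
      - + 2 * (+ 4 * + n)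
        ≡⟨ lem′ (+ n) ⟩
      - + 8 * + n ∎
      where
      lem : ∀ r → + 2 * - r + (+ 2 * (+ 2 * r + 1ℤ)) * - r ≡ - + 2 * (+ 2 * (r * (r + 1ℤ)))
      lem = solve-∀
      lem′ : ∀ n → - + 2 * (+ 4 * n) ≡ - + 8 * n
      lem′ = solve-∀
      sumₜ : ∑ (map (pointₜ r) (upTo m)) (doubled n) ≡ + 2 * - + r
      sumₜ = trans (∑-map (pointₜ r) (upTo m) (doubled n))
        (trans (∑-cong (upTo m) (λ {j} _ → doubled-pointₜ j))
               (trans (∑-distribˡ-* (upTo m) (+ 2) (λ j → κ (+ 2 * + r - + j) * + suc j)) (cong (+ 2 *_) (∑-κ-linear r))))
      sumᵤ : ∑ (map (pointᵤ r) (upTo m)) (doubled n) ≡ (+ 2 * (+ 2 * + r + 1ℤ)) * - + r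
      sumᵤ = trans (∑-map (pointᵤ r) (upTo m) (doubled n))
        (trans (∑-cong (upTo m) (λ {j} j∈ → doubled-pointᵤ j (∈-upTo⁻ j∈)))
               (trans (∑-distribˡ-* (upTo m) (+ 2 * (+ 2 * + r + 1ℤ)) (λ j → κ (+ 2 * (+ 2 * + r - + j)) * η (+ suc j)))
                      (cong ((+ 2 * (+ 2 * + r + 1ℤ)) *_) (∑-κη r))))

  ∑-doubled : ∀ n → ∑ (solutions (4 ℕ.* n ℕ.+ 0)) (doubled n) ≡ - + 8 * D ψ n
  ∑-doubled n with ℕₚ.anyUpTo? (λ r → tri r ℕ.≟ n) (suc n)
  ... | yes (r , _ , refl) = trans (∑-doubled-boundary n) (trans (∑-boundary r)
          (cong (- + 8 *_) (sym (trans (cong (+ n *_) (ψ-tri r)) (ℤₚ.*-identityʳ (+ n))))))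
  ... | no ¬r = trans (∑-doubled-boundary n) (trans (∑-zero (boundary n) absurd)
          (sym (cong (- + 8 *_) (trans (cong (+ n *_) (ψ-nontri n none)) (ℤₚ.*-zeroʳ (+ n))))))
    where
    none : ∀ r → tri r ≢ n
    none r eq = ¬r (r , s≤s (subst (r ≤_) eq (n≤tri r)) , eq)
    absurd : ∀ {z} → z ∈ boundary n → doubled n z ≡ 0ℤ
    absurd {z} p = go (boundary-form n z p)
      where
      go : BoundaryPoint n pointₜ z ⊎ BoundaryPoint n pointᵤ z → doubled n z ≡ 0ℤ
      go (inj₁ (r , eq , _)) = contradiction eq (none r)
      go (inj₂ (r , eq , _)) = contradiction eq (none r)

  -- Only d = 2f and e = 2g contribute, so the coefficient at m is the sum of 2 (−1)^f f over f g = m.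
  evenSeries : Series
  evenSeries = divisorSeries 0 (λ d e → κ d * η e * d)

  -- Averaging over X ↦ -X replaces s by d. The factor 4 cancelled at the end comes from this
  -- average and from the two values of x per triangular number.
  ψ-logarithmicDerivative : ∀ n → - + 2 * D ψ n ≡ (ψ ⊛ evenSeries) n
  ψ-logarithmicDerivative n = ℤₚ.*-cancelˡ-≡ (+ 4) _ _ (begin
    + 4 * (- + 2 * D ψ n)
      ≡⟨ lem₁ (D ψ n) ⟩
    - + 8 * D ψ n
      ≡⟨ sym (∑-doubled n) ⟩
    ∑ L (doubled n)
      ≡⟨ sym (∑-evenWeight-doubled n) ⟩
    + 2 * ∑ L w
      ≡⟨ lem₂ (∑ L w) ⟩
    ∑ L w + ∑ L w
      ≡⟨ cong (_+_ (∑ L w)) (sym (∑-negate-x N w)) ⟩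
    ∑ L w + ∑ L (λ (x , d , e) → w (- x - 1ℤ , d , e))
      ≡⟨ sym (∑-distrib-+ L w (λ (x , d , e) → w (- x - 1ℤ , d , e))) ⟩
    ∑ L (λ (x , d , e) → w (x , d , e) + w (- x - 1ℤ , d , e))
      ≡⟨ ∑-cong L (λ {(x , d , e)} _ → lem₃ (κ d * η e) x d) ⟩
    ∑ L (λ (x , d , e) → + 2 * (κ d * η e * d))
      ≡⟨ ∑-solutions n 0 (s≤s z≤n) (λ d e → κ d * η e * d) (λ _ → + 2) ⟩
    ∑ (upTo (suc N)) (λ k → + 4 * shift (tri k) evenSeries n)
      ≡⟨ ∑-distribˡ-* (upTo (suc N)) (+ 4) (λ k → shift (tri k) evenSeries n) ⟩
    + 4 * ∑ (upTo (suc N)) (λ k → shift (tri k) evenSeries n)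
      ≡⟨ cong (+ 4 *_) (sym (ψ⊛ n<K evenSeries)) ⟩
    + 4 * (ψ ⊛ evenSeries) n ∎)
    where
    N = 4 ℕ.* n ℕ.+ 0
    L = solutions N
    w = evenWeight n
    n<K : n < suc N
    n<K = s≤s (ℕₚ.≤-trans (ℕₚ.m≤n*m n 4) (ℕₚ.m≤m+n (4 ℕ.* n) 0))
    lem₁ : ∀ a → + 4 * (- + 2 * a) ≡ - + 8 * a
    lem₁ = solve-∀
    lem₂ : ∀ a → + 2 * a ≡ a + a
    lem₂ = solve-∀
    lem₃ : ∀ c x d → c * (+ 2 * x + 1ℤ + d) + c * (+ 2 * (- x - 1ℤ) + 1ℤ + d) ≡ + 2 * (c * d)
    lem₃ = solve-∀

  -- Divisor sums

  divisors : ℕ → List ℕ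
  divisors m = filter (_∣? m) (upTo (suc m))

  divisors-unique : ∀ m → Unique (divisors m)
  divisors-unique m = Unique.filter⁺ (_∣? m) (Unique.upTo⁺ (suc m))

  ∈-divisors⁺ : ∀ m {f} → suc f ∣ suc m → suc f ∈ divisors (suc m)
  ∈-divisors⁺ m f∣m = ∈-filter⁺ (_∣? suc m) (∈-upTo⁺ (s≤s (∣⇒≤ f∣m))) f∣m

  ∈-divisors⁻ : ∀ m {f} → f ∈ divisors m → f ∣ m
  ∈-divisors⁻ m p = proj₂ (∈-filter⁻ (_∣? m) {xs = upTo (suc m)} p)

  divisor-positive : ∀ m {f} → f ∣ suc m → ∃ λ f′ → f ≡ suc f′
  divisor-positive m {zero}  (divides q eq) with () ← trans eq (ℕₚ.*-zeroʳ q)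
  divisor-positive m {suc f} _ = f , refl

  +sum : ∀ xs → + sum xs ≡ ∑ xs (λ f → + f)
  +sum []       = refl
  +sum (x ∷ xs) = trans (ℤₚ.pos-+ x (sum xs)) (cong (_+_ (+ x)) (+sum xs))

  η≡1⇒even : ∀ i → η i ≡ 1ℤ → ∃ λ g → i ≡ + 2 * g
  η≡1⇒even i η≡1 = go (parity i)
    where
    go : (∃ λ g → i ≡ + 2 * g) ⊎ (η i ≡ 0ℤ × κ i ≡ 0ℤ) → ∃ λ g → i ≡ + 2 * g
    go (inj₁ even)      = even
    go (inj₂ (η≡0 , _)) with () ← trans (sym η≡0) η≡1

  ≢1⇒η≡0 : ∀ i → η i ≢ 1ℤ → η i ≡ 0ℤ × κ i ≡ 0ℤ
  ≢1⇒η≡0 i η≢1 = go (parity i)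
    where
    go : (∃ λ g → i ≡ + 2 * g) ⊎ (η i ≡ 0ℤ × κ i ≡ 0ℤ) → η i ≡ 0ℤ × κ i ≡ 0ℤ
    go (inj₁ (g , refl)) = contradiction (η-double g) η≢1
    go (inj₂ zeros)      = zeros

  -- Both sides are (-1)^i.
  κ-double : ∀ i → κ (+ 2 * i) ≡ + 2 * η i - 1ℤ
  κ-double i = go (residue i)
    where
    κr : ∀ q r → κ (+ 4 * q + r) ≡ κ r
    κr = cyc-4periodic _ _ _ _
    ηr : ∀ q r → η (+ 4 * q + r) ≡ η r
    ηr = cyc-4periodic _ _ _ _
    lem : ∀ q r → + 2 * (+ 4 * q + r) ≡ + 4 * (+ 2 * q) + + 2 * r
    lem = solve-∀
    case-r : ∀ q r → κ (+ 2 * r) ≡ + 2 * η r - 1ℤ → κ (+ 2 * (+ 4 * q + r)) ≡ + 2 * η (+ 4 * q + r) - 1ℤ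
    case-r q r eq = trans (trans (cong κ (lem q r)) (κr (+ 2 * q) (+ 2 * r))) (trans eq (cong (λ z → + 2 * z - 1ℤ) (sym (ηr q r))))
    go : ∀ {i} → Residue i → κ (+ 2 * i) ≡ + 2 * η i - 1ℤ
    go (r0 q) = case-r q (+ 0) refl
    go (r1 q) = case-r q (+ 1) refl
    go (r2 q) = case-r q (+ 2) refl
    go (r3 q) = case-r q (+ 3) refl

  module _ (m₀ : ℕ) where
    private
      m = suc m₀
      M = 4 ℕ.* m ℕ.+ 0
      w : ℤ × ℤ → ℤ
      w (d , e) = κ d * η e * d
      even? : (p : ℤ × ℤ) → Dec (η (proj₁ p) ≡ 1ℤ × η (proj₂ p) ≡ 1ℤ)
      even? (d , e) = (η d ℤₚ.≟ 1ℤ) ×-dec (η e ℤₚ.≟ 1ℤ)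
      F = factorizations M

    -- `suc (ℕ.pred f)` is f for positive f. It supplies a divisor that is visibly nonzero without a
    -- proof argument, and the divisors of m are positive.
    doubledPair : ℕ → ℤ × ℤ
    doubledPair f = + 2 * + f , + 2 * + (m / suc (ℕ.pred f))

    w-support : ∀ d e → ¬ (η d ≡ 1ℤ × η e ≡ 1ℤ) → w (d , e) ≡ 0ℤ
    w-support d e ¬even = go (η d ℤₚ.≟ 1ℤ) (η e ℤₚ.≟ 1ℤ)
      where
      go : Dec (η d ≡ 1ℤ) → Dec (η e ≡ 1ℤ) → w (d , e) ≡ 0ℤ
      go (yes p) (yes q) = contradiction (p , q) ¬even
      go (no ¬p) _       = cong (λ z → z * η e * d) (proj₂ (≢1⇒η≡0 d ¬p))
      go _       (no ¬q) = trans (cong (λ z → κ d * z * d) (proj₁ (≢1⇒η≡0 e ¬q)))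
                                 (trans (cong (_* d) (ℤₚ.*-zeroʳ (κ d))) (ℤₚ.*-zeroˡ d))

    doubledPair-∈ : ∀ f q → q ℕ.* suc f ≡ m → doubledPair (suc f) ∈ filter even? F
    doubledPair-∈ f (suc q) eq = subst (λ z → (+ 2 * + suc f , + 2 * + z) ∈ filter even? F) (sym quotient)
      (∈-filter⁺ even? (∈-factorizations⁺ _ _ product) (η-double (+ suc f) , η-double (+ suc q)))
      where
      quotient : m / suc f ≡ suc q
      quotient = trans (cong (_/ suc f) (sym eq)) (m*n/n≡m (suc q) (suc f))
      product : (2 ℕ.* suc f) ℕ.* (2 ℕ.* suc q) ≡ M
      product = ℤₚ.+-injective (begin
        + ((2 ℕ.* suc f) ℕ.* (2 ℕ.* suc q))   ≡⟨ ℤₚ.pos-* (2 ℕ.* suc f) (2 ℕ.* suc q) ⟩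
        (+ 2 * + suc f) * (+ 2 * + suc q)     ≡⟨ lem (+ suc f) (+ suc q) ⟩
        + 4 * (+ suc q * + suc f)             ≡⟨ cong (+ 4 *_) (sym (ℤₚ.pos-* (suc q) (suc f))) ⟩
        + 4 * + (suc q ℕ.* suc f)             ≡⟨ cong (λ z → + 4 * + z) eq ⟩
        + 4 * + m                             ≡⟨ sym (ℤₚ.pos-* 4 m) ⟩
        + (4 ℕ.* m)                           ≡⟨ cong +_ (sym (ℕₚ.+-identityʳ (4 ℕ.* m))) ⟩
        + M                                   ∎)
        where
        lem : ∀ a b → (+ 2 * a) * (+ 2 * b) ≡ + 4 * (b * a)
        lem = solve-∀

    evenPairs⇒ : ∀ {p} → p ∈ filter even? F → p ∈ map doubledPair (divisors m)
    evenPairs⇒ {d , e} p = go (∈-factorizations⁻ M (proj₁ q)) (η≡1⇒even d (proj₁ (proj₂ q))) (η≡1⇒even e (proj₂ (proj₂ q)))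
      where
      q : (d , e) ∈ F × (η d ≡ 1ℤ × η e ≡ 1ℤ)
      q = ∈-filter⁻ even? {xs = F} p
      lem : ∀ g h → + 4 * (h * g) ≡ (+ 2 * g) * (+ 2 * h)
      lem = solve-∀
      half : ∀ {a b} g h → suc a ℕ.* suc b ≡ M → + 2 * g ≡ +[1+ a ] → + 2 * h ≡ +[1+ b ] → h * g ≡ + m
      half {a} {b} g h ab≡ g≡ h≡ = ℤₚ.*-cancelˡ-≡ (+ 4) (h * g) (+ m) (begin
        + 4 * (h * g)               ≡⟨ lem g h ⟩
        (+ 2 * g) * (+ 2 * h)       ≡⟨ cong₂ _*_ g≡ h≡ ⟩
        +[1+ a ] * +[1+ b ]         ≡⟨ sym (ℤₚ.pos-* (suc a) (suc b)) ⟩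
        + (suc a ℕ.* suc b)         ≡⟨ cong +_ (trans ab≡ (ℕₚ.+-identityʳ (4 ℕ.* m))) ⟩
        + (4 ℕ.* m)                 ≡⟨ ℤₚ.pos-* 4 m ⟩
        + 4 * + m                   ∎)
      finish : ∀ f h → + suc h * + suc f ≡ + m → d ≡ + 2 * + suc f → e ≡ + 2 * + suc h → (d , e) ∈ map doubledPair (divisors m)
      finish f h hf≡m d≡ e≡ = subst (_∈ map doubledPair (divisors m)) (sym (cong₂ _,_ d≡ (trans e≡ (cong (λ z → + 2 * + z) (sym quotient)))))
        (∈-map⁺ doubledPair (∈-divisors⁺ m₀ (divides (suc h) (sym hf≡mℕ))))
        where
        hf≡mℕ : suc h ℕ.* suc f ≡ m
        hf≡mℕ = ℤₚ.+-injective (trans (ℤₚ.pos-* (suc h) (suc f)) hf≡m)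
        quotient : m / suc f ≡ suc h
        quotient = trans (cong (_/ suc f) (sym hf≡mℕ)) (m*n/n≡m (suc h) (suc f))
      go : (∃₂ λ a b → d ≡ +[1+ a ] × e ≡ +[1+ b ] × suc a ℕ.* suc b ≡ M) →
           (∃ λ g → d ≡ + 2 * g) → (∃ λ h → e ≡ + 2 * h) → (d , e) ∈ map doubledPair (divisors m)
      go (a , b , d≡ , e≡ , ab≡) (g , dg) (h , eh) = go′ (half-positive g (trans (sym dg) d≡)) (half-positive h (trans (sym eh) e≡))
        where
        go′ : Positive g → Positive h → (d , e) ∈ map doubledPair (divisors m)
        go′ (f , refl) (k , refl) = finish f k (half (+ suc f) (+ suc k) ab≡ (trans (sym dg) d≡) (trans (sym eh) e≡)) dg eh

    ⇒evenPairs : ∀ {p} → p ∈ map doubledPair (divisors m) → p ∈ filter even? F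
    ⇒evenPairs {p} p∈ = go (∈-map⁻ doubledPair p∈)
      where
      go : (∃ λ f → f ∈ divisors m × p ≡ doubledPair f) → p ∈ filter even? F
      go (f , f∈ , p≡) = go′ f (∈-divisors⁻ m f∈) (divisor-positive m₀ (∈-divisors⁻ m f∈)) p≡
        where
        go′ : ∀ f → f ∣ m → (∃ λ f′ → f ≡ suc f′) → p ≡ doubledPair f → p ∈ filter even? F
        go′ _ (divides q eq) (f′ , refl) p≡ = subst (_∈ filter even? F) (sym p≡) (doubledPair-∈ f′ q (sym eq))

    -- The factorizations of 4m into even factors are (2f, 2m/f) with f dividing m; the weight
    -- 2(-1)^f f then splits into all divisors and even divisors.
    evenSeries-divisors : evenSeries m ≡ - + 2 * ∑ (divisors m) (λ f → + f) + + 4 * ∑ (divisors m) (λ f → η (+ f) * + f)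
    evenSeries-divisors = begin
      ∑ F w
        ≡⟨ ∑-filter-support even? F (λ {(d , e)} _ → w-support d e) ⟩
      ∑ (filter even? F) w
        ≡⟨ ∑-set-cong (Unique.filter⁺ even? (factorizations-unique M)) (Unique.map⁺ injective (divisors-unique m)) evenPairs⇒ ⇒evenPairs w ⟩
      ∑ (map doubledPair (divisors m)) w
        ≡⟨ ∑-map doubledPair (divisors m) w ⟩
      ∑ (divisors m) (λ f → κ (+ 2 * + f) * η (+ 2 * + (m / suc (ℕ.pred f))) * (+ 2 * + f))
        ≡⟨ ∑-cong (divisors m) (λ {f} _ → trans (cong₂ (λ y z → y * z * (+ 2 * + f)) (κ-double (+ f)) (η-double (+ (m / suc (ℕ.pred f)))))
                                                (lem (η (+ f)) (+ f))) ⟩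
      ∑ (divisors m) (λ f → - + 2 * + f + + 4 * (η (+ f) * + f))
        ≡⟨ ∑-distrib-+ (divisors m) (λ f → - + 2 * + f) (λ f → + 4 * (η (+ f) * + f)) ⟩
      ∑ (divisors m) (λ f → - + 2 * + f) + ∑ (divisors m) (λ f → + 4 * (η (+ f) * + f))
        ≡⟨ cong₂ _+_ (∑-distribˡ-* (divisors m) (- + 2) (λ f → + f)) (∑-distribˡ-* (divisors m) (+ 4) (λ f → η (+ f) * + f)) ⟩
      - + 2 * ∑ (divisors m) (λ f → + f) + + 4 * ∑ (divisors m) (λ f → η (+ f) * + f) ∎
      where
      injective : ∀ {f g} → doubledPair f ≡ doubledPair g → f ≡ g
      injective {f} {g} eq = ℤₚ.+-injective (ℤₚ.*-cancelˡ-≡ (+ 2) (+ f) (+ g) (cong proj₁ eq))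
      lem : ∀ c f → (+ 2 * c - 1ℤ) * 1ℤ * (+ 2 * f) ≡ - + 2 * f + + 4 * (c * f)
      lem = solve-∀

  σhalf-even : ∀ k → k % 2 ≡ 0 → σhalf k ≡ σ (k / 2)
  σhalf-even k eq with k % 2 | eq
  ... | zero | _ = refl

  σhalf-odd : ∀ k → k % 2 ≡ 1 → σhalf k ≡ 0
  σhalf-odd k eq with k % 2 | eq
  ... | suc _ | _ = refl

  -- The even divisors of 2m are the doubles of the divisors of m.
  ∑-even-divisors-even : ∀ m → ∑ (divisors (suc m ℕ.* 2)) (λ f → η (+ f) * + f) ≡ + 2 * + σ (suc m)
  ∑-even-divisors-even m₀ = begin
    ∑ (divisors M) w
      ≡⟨ ∑-filter-support even? (divisors M) (λ {f} _ odd → trans (cong (_* + f) (proj₁ (≢1⇒η≡0 (+ f) odd))) (ℤₚ.*-zeroˡ (+ f))) ⟩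
    ∑ (filter even? (divisors M)) w
      ≡⟨ ∑-set-cong (Unique.filter⁺ even? (divisors-unique M)) (Unique.map⁺ (λ {f} {g} → ℕₚ.*-cancelˡ-≡ f g 2) (divisors-unique m)) to from w ⟩
    ∑ (map (2 ℕ.*_) (divisors m)) w
      ≡⟨ ∑-map (2 ℕ.*_) (divisors m) w ⟩
    ∑ (divisors m) (λ f → η (+ (2 ℕ.* f)) * + (2 ℕ.* f))
      ≡⟨ ∑-cong (divisors m) (λ {f} _ → trans (cong (_* + (2 ℕ.* f)) (trans (cong η (ℤₚ.pos-* 2 f)) (η-double (+ f))))
                                              (trans (ℤₚ.*-identityˡ (+ (2 ℕ.* f))) (ℤₚ.pos-* 2 f))) ⟩
    ∑ (divisors m) (λ f → + 2 * + f)
      ≡⟨ ∑-distribˡ-* (divisors m) (+ 2) (λ f → + f) ⟩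
    + 2 * ∑ (divisors m) (λ f → + f)
      ≡⟨ cong (+ 2 *_) (sym (+sum (divisors m))) ⟩
    + 2 * + σ m ∎
    where
    m = suc m₀
    M = m ℕ.* 2
    w : ℕ → ℤ
    w f = η (+ f) * + f
    even? = λ (f : ℕ) → η (+ f) ℤₚ.≟ 1ℤ
    to : ∀ {f} → f ∈ filter even? (divisors M) → f ∈ map (2 ℕ.*_) (divisors m)
    to {f} p = go (η≡1⇒even (+ f) (proj₂ q)) (divisor-positive _ f∣M)
      where
      q : f ∈ divisors M × η (+ f) ≡ 1ℤ
      q = ∈-filter⁻ even? {xs = divisors M} p
      f∣M : f ∣ M
      f∣M = ∈-divisors⁻ M (proj₁ q)
      go : (∃ λ g → + f ≡ + 2 * g) → (∃ λ f′ → f ≡ suc f′) → f ∈ map (2 ℕ.*_) (divisors m)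
      go (g , f≡) (f′ , f≡suc) = go′ (half-positive g (trans (sym f≡) (cong +_ f≡suc)))
        where
        go′ : Positive g → f ∈ map (2 ℕ.*_) (divisors m)
        go′ (h , g≡) = subst (_∈ map (2 ℕ.*_) (divisors m)) (sym f≡2h)
          (∈-map⁺ (2 ℕ.*_) (∈-divisors⁺ m₀ (*-cancelˡ-∣ 2 (subst₂ _∣_ f≡2h (ℕₚ.*-comm m 2) f∣M))))
          where
          f≡2h : f ≡ 2 ℕ.* suc h
          f≡2h = ℤₚ.+-injective (trans f≡ (trans (cong (+ 2 *_) g≡) (sym (ℤₚ.pos-* 2 (suc h)))))
    from : ∀ {f} → f ∈ map (2 ℕ.*_) (divisors m) → f ∈ filter even? (divisors M)
    from {f} p = go (∈-map⁻ (2 ℕ.*_) p)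
      where
      go : (∃ λ g → g ∈ divisors m × f ≡ 2 ℕ.* g) → f ∈ filter even? (divisors M)
      go (g , g∈ , f≡) = go′ (divisor-positive m₀ (∈-divisors⁻ m g∈))
        where
        go′ : (∃ λ g′ → g ≡ suc g′) → f ∈ filter even? (divisors M)
        go′ (g′ , g≡) = subst (_∈ filter even? (divisors M)) (sym (trans f≡ (cong (2 ℕ.*_) g≡)))
          (∈-filter⁺ even? (∈-divisors⁺ _ (subst₂ _∣_ (cong (2 ℕ.*_) g≡) (ℕₚ.*-comm 2 m) (*-monoʳ-∣ 2 (∈-divisors⁻ m g∈))))
                           (trans (cong η (ℤₚ.pos-* 2 (suc g′))) (η-double (+ suc g′))))

  ∑-even-divisors-odd : ∀ m → η (+ m) ≡ 0ℤ → ∑ (divisors m) (λ f → η (+ f) * + f) ≡ 0ℤ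
  ∑-even-divisors-odd m odd = ∑-zero (divisors m) (λ {f} f∈ → go f (∈-divisors⁻ m f∈) (parity (+ f)))
    where
    go : ∀ f → f ∣ m → (∃ λ g → + f ≡ + 2 * g) ⊎ (η (+ f) ≡ 0ℤ × κ (+ f) ≡ 0ℤ) → η (+ f) * + f ≡ 0ℤ
    go f _ (inj₂ (η≡0 , _)) = trans (cong (_* + f) η≡0) (ℤₚ.*-zeroˡ (+ f))
    go f (divides q eq) (inj₁ (g , f≡)) = contradiction (trans (sym odd) (trans (cong η m≡) (η-double (+ q * g)))) λ ()
      where
      lem : ∀ q g → q * (+ 2 * g) ≡ + 2 * (q * g)
      lem = solve-∀
      m≡ : + m ≡ + 2 * (+ q * g)
      m≡ = trans (cong +_ eq) (trans (ℤₚ.pos-* q f) (trans (cong (+ q *_) f≡) (lem (+ q) g)))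

  ∑-even-divisors : ∀ m → ∑ (divisors (suc m)) (λ f → η (+ f) * + f) ≡ + 2 * + σhalf (suc m)
  ∑-even-divisors m₀ = go (m % 2) (m / 2) refl refl (m%n<n m 2)
    where
    m = suc m₀
    go : ∀ r q → m % 2 ≡ r → m / 2 ≡ q → r < 2 → ∑ (divisors m) (λ f → η (+ f) * + f) ≡ + 2 * + σhalf m
    -- A zero quotient would make m zero, so the convention for `σ zero` is not reached.
    go 0 zero    r≡ q≡ _ with () ← trans (m≡m%n+[m/n]*n m 2) (cong₂ (λ y z → y ℕ.+ z ℕ.* 2) r≡ q≡)
    go 0 (suc q) r≡ q≡ _ = begin
      ∑ (divisors m) (λ f → η (+ f) * + f)
        ≡⟨ cong (λ z → ∑ (divisors z) (λ f → η (+ f) * + f)) (trans (m≡m%n+[m/n]*n m 2) (cong₂ (λ y z → y ℕ.+ z ℕ.* 2) r≡ q≡)) ⟩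
      ∑ (divisors (suc q ℕ.* 2)) (λ f → η (+ f) * + f)
        ≡⟨ ∑-even-divisors-even q ⟩
      + 2 * + σ (suc q)
        ≡⟨ cong (λ z → + 2 * + z) (sym (trans (σhalf-even m r≡) (cong σ q≡))) ⟩
      + 2 * + σhalf m ∎
    go 1 q r≡ q≡ _ = trans (∑-even-divisors-odd m odd) (cong (λ z → + 2 * + z) (sym (σhalf-odd m r≡)))
      where
      odd : η (+ m) ≡ 0ℤ
      odd = trans (cong (λ z → η (+ z)) (trans (m≡m%n+[m/n]*n m 2) (cong₂ (λ y z → y ℕ.+ z ℕ.* 2) r≡ q≡)))
        (trans (cong η (trans (cong (_+_ 1ℤ) (trans (ℤₚ.pos-* q 2) (ℤₚ.*-comm (+ q) (+ 2)))) (ℤₚ.+-comm 1ℤ (+ 2 * + q)))) (η-2periodic (+ q) 1ℤ))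
    go (suc (suc r)) q _ _ (s≤s (s≤s ()))

  evenSeries-σ : ∀ m → evenSeries (suc m) ≡ - + 2 * (+ σ (suc m) - + 4 * + σhalf (suc m))
  evenSeries-σ m = begin
    evenSeries (suc m)
      ≡⟨ evenSeries-divisors m ⟩
    - + 2 * ∑ (divisors (suc m)) (λ f → + f) + + 4 * ∑ (divisors (suc m)) (λ f → η (+ f) * + f)
      ≡⟨ cong₂ (λ y z → - + 2 * y + + 4 * z) (sym (+sum (divisors (suc m)))) (∑-even-divisors m) ⟩
    - + 2 * + σ (suc m) + + 4 * (+ 2 * + σhalf (suc m))
      ≡⟨ lem (+ σ (suc m)) (+ σhalf (suc m)) ⟩
    - + 2 * (+ σ (suc m) - + 4 * + σhalf (suc m)) ∎
    where
    lem : ∀ a b → - + 2 * a + + 4 * (+ 2 * b) ≡ - + 2 * (a - + 4 * b)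
    lem = solve-∀

  -- The number of representations

  ∑-factorizations-prime : ∀ m → Prime (suc m) → (f : ℤ × ℤ → ℤ) →
    ∑ (factorizations (suc m)) f ≡ f (1ℤ , + suc m) + f (+ suc m , 1ℤ)
  ∑-factorizations-prime m isPrime f = begin
    ∑ (factorizations p) f
      ≡⟨ ∑-set-cong (factorizations-unique p) ((different ∷ []) ∷ ([] ∷ [])) to from f ⟩
    f (1ℤ , + p) + (f (+ p , 1ℤ) + 0ℤ)
      ≡⟨ cong (_+_ (f (1ℤ , + p))) (ℤₚ.+-identityʳ (f (+ p , 1ℤ))) ⟩
    f (1ℤ , + p) + f (+ p , 1ℤ) ∎
    where
    p = suc m
    trivial = (1ℤ , + p) ∷ (+ p , 1ℤ) ∷ []
    different : (1ℤ , + p) ≢ (+ p , 1ℤ)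
    different eq with refl ← ℤₚ.+-injective (cong proj₁ eq) = ℕ.nonTrivial⇒≢1 {{prime⇒nonTrivial isPrime}} refl
    to : ∀ {z} → z ∈ factorizations p → z ∈ trivial
    to {d , e} z∈ = go (∈-factorizations⁻ p z∈)
      where
      go : (∃₂ λ a b → d ≡ +[1+ a ] × e ≡ +[1+ b ] × suc a ℕ.* suc b ≡ p) → (d , e) ∈ trivial
      go (a , b , refl , refl , eq) = go′ (prime⇒irreducible isPrime (divides (suc b) (trans (sym eq) (ℕₚ.*-comm (suc a) (suc b)))))
        where
        go′ : suc a ≡ 1 ⊎ suc a ≡ p → (+[1+ a ] , +[1+ b ]) ∈ trivial
        go′ (inj₁ refl) = here (cong (λ z → 1ℤ , + z) (trans (sym (ℕₚ.*-identityˡ (suc b))) eq))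
        go′ (inj₂ refl) = there (here (cong (λ z → + p , + z)
          (ℕₚ.*-cancelˡ-≡ (suc b) 1 p (trans eq (sym (ℕₚ.*-identityʳ p))))))
    from : ∀ {z} → z ∈ trivial → z ∈ factorizations p
    from (here refl)         = ∈-factorizations⁺ 0 m (ℕₚ.*-identityˡ p)
    from (there (here refl)) = ∈-factorizations⁺ m 0 (ℕₚ.*-identityʳ p)

  cubicSeries-prime : ∀ n → Prime (4 ℕ.* n ℕ.+ 3) → cubicSeries n ≡ 1ℤ - (+ 4 * + n + + 3) * (+ 4 * + n + + 3)
  cubicSeries-prime n isPrime = begin
    ∑ (factorizations N) f
      ≡⟨ cong (λ z → ∑ (factorizations z) f) N≡ ⟩
    ∑ (factorizations p) f
      ≡⟨ ∑-factorizations-prime (4 ℕ.* n ℕ.+ 2) (subst Prime N≡ isPrime) f ⟩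
    1ℤ + χ (+ p) * (+ p * + p)
      ≡⟨ cong (λ z → 1ℤ + χ z * (z * z)) (trans (cong +_ (sym N≡)) N≡ℤ) ⟩
    1ℤ + χ N′ * (N′ * N′)
      ≡⟨ cong (λ z → 1ℤ + z * (N′ * N′)) (cyc-4periodic _ _ _ _ (+ n) (+ 3)) ⟩
    1ℤ + -1ℤ * (N′ * N′)
      ≡⟨ cong (_+_ 1ℤ) (ℤₚ.-1*i≡-i (N′ * N′)) ⟩
    1ℤ - N′ * N′ ∎
    where
    N = 4 ℕ.* n ℕ.+ 3
    p = suc (4 ℕ.* n ℕ.+ 2)
    N′ = + 4 * + n + + 3
    f : ℤ × ℤ → ℤ
    f (d , e) = χ d * (d * d)
    N≡ : N ≡ p
    N≡ = ℕₚ.+-suc (4 ℕ.* n) 2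
    N≡ℤ : + N ≡ N′
    N≡ℤ = trans (ℤₚ.pos-+ (4 ℕ.* n) 3) (cong (_+ + 3) (ℤₚ.pos-* 4 n))

  -- Comparison with the sixth power of ψ, and the convolution

  open LogarithmicDerivative ψ evenSeries (- + 2) ψ-logarithmicDerivative

  cubicSeries≡-8t6 : ∀ n → cubicSeries n ≡ - + 8 * + t6 n
  -- The initial values agree by computation: the factorizations of 3 give 1 - 9 = -8, and ψ⁶ starts
  -- with 1.
  cubicSeries≡-8t6 n = trans (unique-solution ψ (+ 6) cubicSeries L refl cubicSeries-recurrence L-recurrence refl n)
                             (cong (- + 8 *_) (sym (t6≡ψ^6 n)))
    where
    L : Series
    L i = - + 8 * (ψ ^⊛ 6) i
    lem : ∀ n a → n * (- + 8 * a) ≡ - + 8 * (n * a)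
    lem = solve-∀
    lem′ : ∀ a → - + 8 * (+ 6 * a) ≡ + 6 * (- + 8 * a)
    lem′ = solve-∀
    L-recurrence : ∀ n → (ψ ⊛ D L) n ≡ + 6 * (D ψ ⊛ L) n
    L-recurrence n = begin
      (ψ ⊛ D L) n                                    ≡⟨ ⊛-cong {ψ} (λ _ → refl) (λ i → lem (+ i) ((ψ ^⊛ 6) i)) n ⟩
      (ψ ⊛ (λ i → - + 8 * D (ψ ^⊛ 6) i)) n           ≡⟨ ⊛-scaleʳ (- + 8) ψ (D (ψ ^⊛ 6)) n ⟩
      - + 8 * (ψ ⊛ D (ψ ^⊛ 6)) n                     ≡⟨ cong (- + 8 *_) (⊛-D-^⊛ 6 n) ⟩
      - + 8 * (+ 6 * (D ψ ⊛ ψ ^⊛ 6) n)               ≡⟨ lem′ ((D ψ ⊛ ψ ^⊛ 6) n) ⟩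
      + 6 * (- + 8 * (D ψ ⊛ ψ ^⊛ 6) n)               ≡⟨ cong (+ 6 *_) (sym (⊛-scaleʳ (- + 8) (D ψ) (ψ ^⊛ 6) n)) ⟩
      + 6 * (D ψ ⊛ L) n                              ∎

  t6-prime : ∀ n → Prime (4 ℕ.* n ℕ.+ 3) → + t6 n ≡ (+ n + 1ℤ) * (+ 2 * + n + 1ℤ)
  t6-prime n isPrime = ℤₚ.*-cancelˡ-≡ (- + 8) (+ t6 n) ((+ n + 1ℤ) * (+ 2 * + n + 1ℤ)) (begin
    - + 8 * + t6 n                                        ≡⟨ sym (cubicSeries≡-8t6 n) ⟩
    cubicSeries n                                         ≡⟨ cubicSeries-prime n isPrime ⟩
    1ℤ - (+ 4 * + n + + 3) * (+ 4 * + n + + 3)            ≡⟨ lem (+ n) ⟩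
    - + 8 * ((+ n + 1ℤ) * (+ 2 * + n + 1ℤ))               ∎)
    where
    lem : ∀ n → 1ℤ - (+ 4 * n + + 3) * (+ 4 * n + + 3) ≡ - + 8 * ((n + 1ℤ) * (+ 2 * n + 1ℤ))
    lem = solve-∀

  convolution : ℕ → ℤ
  convolution n = sumBelow n (λ j → + t6 j * (+ σ (n ∸ j) - + 4 * + σhalf (n ∸ j)))

  ψ^6⊛evenSeries : ∀ n → (ψ ^⊛ 6 ⊛ evenSeries) n ≡ - + 2 * convolution n
  ψ^6⊛evenSeries n = begin
    (ψ ^⊛ 6 ⊛ evenSeries) n
      ≡⟨ ⊛-sumBelow n (ψ ^⊛ 6) evenSeries ⟩
    sumBelow n (λ j → (ψ ^⊛ 6) j * evenSeries (n ∸ j)) + (ψ ^⊛ 6) n * evenSeries (n ∸ n)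
      ≡⟨ cong₂ _+_ (trans (sumBelow-cong n (λ {j} → term j)) (sumBelow-distribˡ-* n (- + 2) (λ j → + t6 j * (+ σ (n ∸ j) - + 4 * + σhalf (n ∸ j)))))
                   -- The term j = n vanishes because `evenSeries 0` is an empty sum, which explains
                   -- the upper limit n - 1.
                   (trans (cong (λ z → (ψ ^⊛ 6) n * evenSeries z) (ℕₚ.n∸n≡0 n)) (ℤₚ.*-zeroʳ ((ψ ^⊛ 6) n))) ⟩
    - + 2 * convolution n + 0ℤ
      ≡⟨ ℤₚ.+-identityʳ (- + 2 * convolution n) ⟩
    - + 2 * convolution n ∎
    where
    lem : ∀ a b → a * (- + 2 * b) ≡ - + 2 * (a * b)
    lem = solve-∀
    at-positive : ∀ m → 0 < m → evenSeries m ≡ - + 2 * (+ σ m - + 4 * + σhalf m)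
    at-positive (suc m) _ = evenSeries-σ m
    term : ∀ j → j < n → (ψ ^⊛ 6) j * evenSeries (n ∸ j) ≡ - + 2 * (+ t6 j * (+ σ (n ∸ j) - + 4 * + σhalf (n ∸ j)))
    term j j<n = trans (cong₂ _*_ (sym (t6≡ψ^6 j)) (at-positive (n ∸ j) (ℕₚ.m<n⇒0<n∸m j<n)))
                       (lem (+ t6 j) (+ σ (n ∸ j) - + 4 * + σhalf (n ∸ j)))

  convolution-t6 : ∀ n → + 6 * convolution n ≡ + n * + t6 n
  convolution-t6 n = ℤₚ.*-cancelˡ-≡ (- + 2) (+ 6 * convolution n) (+ n * + t6 n) (begin
    - + 2 * (+ 6 * convolution n)       ≡⟨ lem (convolution n) ⟩
    + 6 * (- + 2 * convolution n)       ≡⟨ cong (+ 6 *_) (sym (ψ^6⊛evenSeries n)) ⟩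
    + 6 * (ψ ^⊛ 6 ⊛ evenSeries) n       ≡⟨ sym (D-^⊛ 6 n) ⟩
    - + 2 * (+ n * (ψ ^⊛ 6) n)          ≡⟨ cong (λ z → - + 2 * (+ n * z)) (sym (t6≡ψ^6 n)) ⟩
    - + 2 * (+ n * + t6 n)              ∎)
    where
    lem : ∀ a → - + 2 * (+ 6 * a) ≡ + 6 * (- + 2 * a)
    lem = solve-∀

  -- Shows that the truncating division in the statement is exact; a negative i is impossible
  -- because 6i would be negative.
  6*i≡+m⇒i≡m/6 : ∀ i {m} → + 6 * i ≡ + m → i ≡ + (m / 6)
  6*i≡+m⇒i≡m/6 (+ k) {m} eq = cong +_ (trans (sym (m*n/n≡m k 6)) (cong (_/ 6)
    (ℤₚ.+-injective (trans (ℤₚ.pos-* k 6) (trans (ℤₚ.*-comm (+ k) (+ 6)) eq)))))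

  6*convolution : ∀ n → Prime (4 ℕ.* n ℕ.+ 3) → + 6 * convolution n ≡ + (n ℕ.* (n ℕ.+ 1) ℕ.* (2 ℕ.* n ℕ.+ 1))
  6*convolution n isPrime = begin
    + 6 * convolution n                              ≡⟨ convolution-t6 n ⟩
    + n * + t6 n                                     ≡⟨ cong (+ n *_) (t6-prime n isPrime) ⟩
    + n * ((+ n + 1ℤ) * (+ 2 * + n + 1ℤ))            ≡⟨ sym (ℤₚ.*-assoc (+ n) (+ n + 1ℤ) (+ 2 * + n + 1ℤ)) ⟩
    + n * + (n ℕ.+ 1) * (+ 2 * + n + 1ℤ)             ≡⟨ cong₂ (λ y z → y * (z + 1ℤ)) (sym (ℤₚ.pos-* n (n ℕ.+ 1))) (sym (ℤₚ.pos-* 2 n)) ⟩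
    + (n ℕ.* (n ℕ.+ 1)) * + (2 ℕ.* n ℕ.+ 1)          ≡⟨ sym (ℤₚ.pos-* (n ℕ.* (n ℕ.+ 1)) (2 ℕ.* n ℕ.+ 1)) ⟩
    + (n ℕ.* (n ℕ.+ 1) ℕ.* (2 ℕ.* n ℕ.+ 1))          ∎


open import Data.Nat using (_+_; _*_)

theorem4p3 : (n : ℕ) → Prime (4 * n + 3) →
    sumBelow n (λ j → (+ t6 j) ℤ.* ((+ σ (n ∸ j)) ℤ.- (+ 4) ℤ.* (+ σhalf (n ∸ j))))
    ≡ + ((n * (n + 1) * (2 * n + 1)) / 6)
theorem4p3 n isPrime = 6*i≡+m⇒i≡m/6 (convolution n) (6*convolution n isPrime)
  where open SixTriangularNumbers using (convolution; 6*convolution; 6*i≡+m⇒i≡m/6)
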